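{- Let $X$ be an unweighted graph on $n$ vertices and let $M\in\{L(X),Q(X)\}$. Let $\overline{d}=2|E(X)|/n$ be the average degree of $X$ and $\Delta$ its maximum degree. If local $\epsilon$-uniform mixing occurs at a vertex $u$ of $X$ relative to $M$, then $\deg u\le 2\overline{d}$. In particular, if $\epsilon$-uniform mixing occurs in $X$ relative to $M$, then $\Delta\le 2\overline{d}$.
   Context: Graphs are finite, simple, undirected and connected; unweighted means all edges have weight $1$. $A(X)$ is the adjacency matrix, $D(X)$ the diagonal matrix of vertex degrees, $L(X)=D(X)-A(X)$ the Laplacian and $Q(X)=D(X)+A(X)$ the signless Laplacian. For $M$, put $U(t)=e^{\mathrm{i}tM}$. $\mathbf{e}_u$ is the characteristic vector of $u$, $\mathbf{1}$ the all-ones vector, $\circ$ the entrywise product. Local $\epsilon$-uniform mixing occurs at $u$ relative to $M$ if for each $\epsilon>0$ there is a time $\tau\in\mathbb{R}$ such that $\big\|(U(\tau)\mathbf{e}_u)\circ(\overline{U(\tau)}\mathbf{e}_u)-\tfrac1n\mathbf{1}\big\|<\epsilon$. $\epsilon$-uniform mixing occurs in $X$ if for each $\epsilon>0$ there is a $\tau$ for which this inequality holds simultaneously for all vertices $u$. -}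

module Defs where

open import Level using (0ℓ)
open import Data.Bool using (if_then_else_)
open import Data.Nat as ℕ using (ℕ; zero; suc; NonZero; _!)
import Data.Nat.Properties as ℕP
open import Data.Integer as ℤ using (ℤ; +_)
open import Data.Rational as ℚ using (ℚ; 0ℚ; 1ℚ; ½)
import Data.Rational.Properties as ℚP
open import Data.Rational.Solver using (module +-*-Solver)
open import Data.Fin as Fin using (Fin)
open import Data.List using (List; length; filter; allFin; cartesianProduct; map)
open import Data.List.Extrema.Nat using (max)
open import Data.Product using (∃-syntax; _×_; _,_)
open import Data.Vec.Functional using (Vector; foldr)
open import Relation.Nullary using (¬_)
open import Relation.Nullary.Decidable using (⌊_⌋; _×-dec_)
open import Relation.Binary.Core using (Rel)
open import Relation.Binary.Definitions using (Decidable; Symmetric; Irreflexive)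
open import Relation.Binary.PropositionalEquality using (_≡_; refl; sym; trans; cong; subst)
open import Relation.Binary.Construct.Closure.ReflexiveTransitive using (Star)

------------------------------------------------------------------------
-- Real numbers: Cauchy sequences of rationals, with _≈ℝ_ as equality

IsCauchy : (ℕ → ℚ) → Set
IsCauchy x = ∀ ε → 0ℚ ℚ.< ε →
  ∃[ N ] (∀ m n → N ℕ.≤ m → N ℕ.≤ n → ℚ.∣ x m ℚ.- x n ∣ ℚ.< ε)

record ℝ : Set where
  constructor mkℝ
  field
    seq    : ℕ → ℚ
    cauchy : IsCauchy seq
open ℝ public

infix 4 _≈ℝ_ _<ℝ_ _≤ℝ_

_≈ℝ_ : ℝ → ℝ → Set
x ≈ℝ y = ∀ ε → 0ℚ ℚ.< ε →
  ∃[ N ] (∀ n → N ℕ.≤ n → ℚ.∣ seq x n ℚ.- seq y n ∣ ℚ.< ε)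

_<ℝ_ : ℝ → ℝ → Set
x <ℝ y = ∃[ ε ] (0ℚ ℚ.< ε × ∃[ N ] (∀ n → N ℕ.≤ n → seq x n ℚ.+ ε ℚ.≤ seq y n))

_≤ℝ_ : ℝ → ℝ → Set
x ≤ℝ y = ¬ (y <ℝ x)

private
  open +-*-Solver using (solve; _:+_; _:*_; :-_; _:-_; _:=_)

  abstract
    +-regroup : ∀ a b c d → (a ℚ.+ b) ℚ.- (c ℚ.+ d) ≡ (a ℚ.- c) ℚ.+ (b ℚ.- d)
    +-regroup = solve 4 (λ a b c d → (a :+ b) :- (c :+ d) := (a :- c) :+ (b :- d)) refl

    *-regroup : ∀ a b c d → a ℚ.* b ℚ.- c ℚ.* d ≡ a ℚ.* (b ℚ.- d) ℚ.+ d ℚ.* (a ℚ.- c)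
    *-regroup = solve 4 (λ a b c d → a :* b :- c :* d := a :* (b :- d) :+ d :* (a :- c)) refl

    neg-regroup : ∀ a b → ℚ.- (a ℚ.- b) ≡ (ℚ.- a) ℚ.- (ℚ.- b)
    neg-regroup = solve 2 (λ a b → :- (a :- b) := (:- a) :- (:- b)) refl

    split : ∀ a b → a ≡ b ℚ.+ (a ℚ.- b)
    split = solve 2 (λ a b → a := b :+ (a :- b)) refl

    ½-pos : ∀ ε → 0ℚ ℚ.< ε → 0ℚ ℚ.< ½ ℚ.* ε
    ½-pos ε 0<ε = subst (ℚ._< ½ ℚ.* ε) (ℚP.*-zeroʳ ½) (ℚP.*-monoʳ-<-pos ½ 0<ε)

    ½+½ : ∀ ε → ½ ℚ.* ε ℚ.+ ½ ℚ.* ε ≡ ε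
    ½+½ ε = trans (sym (ℚP.*-distribʳ-+ ε ½ ½)) (ℚP.*-identityˡ ε)

    const-cauchy : ∀ q → IsCauchy (λ _ → q)
    const-cauchy q ε 0<ε = 0 , λ _ _ _ _ →
      subst (λ z → ℚ.∣ z ∣ ℚ.< ε) (sym (ℚP.+-inverseʳ q)) 0<ε

    +-cauchy : ∀ x y → IsCauchy x → IsCauchy y → IsCauchy (λ n → x n ℚ.+ y n)
    +-cauchy x y cx cy ε 0<ε with cx (½ ℚ.* ε) (½-pos ε 0<ε) | cy (½ ℚ.* ε) (½-pos ε 0<ε)
    ... | N₁ , p | N₂ , q = N₁ ℕ.⊔ N₂ , λ m n N≤m N≤n → begin-strict
        ℚ.∣ (x m ℚ.+ y m) ℚ.- (x n ℚ.+ y n) ∣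
          ≡⟨ cong ℚ.∣_∣ (+-regroup (x m) (y m) (x n) (y n)) ⟩
        ℚ.∣ (x m ℚ.- x n) ℚ.+ (y m ℚ.- y n) ∣
          ≤⟨ ℚP.∣p+q∣≤∣p∣+∣q∣ (x m ℚ.- x n) (y m ℚ.- y n) ⟩
        ℚ.∣ x m ℚ.- x n ∣ ℚ.+ ℚ.∣ y m ℚ.- y n ∣
          <⟨ ℚP.+-mono-< (p m n (ℕP.m⊔n≤o⇒m≤o N₁ N₂ N≤m) (ℕP.m⊔n≤o⇒m≤o N₁ N₂ N≤n))
                         (q m n (ℕP.m⊔n≤o⇒n≤o N₁ N₂ N≤m) (ℕP.m⊔n≤o⇒n≤o N₁ N₂ N≤n)) ⟩
        ½ ℚ.* ε ℚ.+ ½ ℚ.* ε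
          ≡⟨ ½+½ ε ⟩
        ε ∎
      where open ℚP.≤-Reasoning

    neg-cauchy : ∀ x → IsCauchy x → IsCauchy (λ n → ℚ.- x n)
    neg-cauchy x cx ε 0<ε with cx ε 0<ε
    ... | N , p = N , λ m n N≤m N≤n → subst (ℚ._< ε)
        (trans (sym (ℚP.∣-p∣≡∣p∣ (x m ℚ.- x n)))
               (cong ℚ.∣_∣ (neg-regroup (x m) (x n))))
        (p m n N≤m N≤n)

    bounded : ∀ x → IsCauchy x →
              ∃[ B ] (0ℚ ℚ.< B × ∃[ N ] (∀ n → N ℕ.≤ n → ℚ.∣ x n ∣ ℚ.≤ B))
    bounded x cx with cx 1ℚ (ℚP.positive⁻¹ 1ℚ)
    ... | N , p = ℚ.∣ x N ∣ ℚ.+ 1ℚ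
                , ℚP.+-mono-≤-< (ℚP.0≤∣p∣ (x N)) (ℚP.positive⁻¹ 1ℚ)
                , N , λ n N≤n → begin
        ℚ.∣ x n ∣
          ≡⟨ cong ℚ.∣_∣ (split (x n) (x N)) ⟩
        ℚ.∣ x N ℚ.+ (x n ℚ.- x N) ∣
          ≤⟨ ℚP.∣p+q∣≤∣p∣+∣q∣ (x N) (x n ℚ.- x N) ⟩
        ℚ.∣ x N ∣ ℚ.+ ℚ.∣ x n ℚ.- x N ∣
          ≤⟨ ℚP.+-monoʳ-≤ ℚ.∣ x N ∣ (ℚP.<⇒≤ (p n N N≤n ℕP.≤-refl)) ⟩
        ℚ.∣ x N ∣ ℚ.+ 1ℚ ∎
      where open ℚP.≤-Reasoning

    *-bound : ∀ {a b B δ} → 0ℚ ℚ.< B → ℚ.∣ a ∣ ℚ.≤ B → ℚ.∣ b ∣ ℚ.< δ → ℚ.∣ a ℚ.* b ∣ ℚ.< B ℚ.* δ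
    *-bound {a} {b} {B} {δ} 0<B a≤B b<δ = begin-strict
        ℚ.∣ a ℚ.* b ∣          ≡⟨ ℚP.∣p*q∣≡∣p∣*∣q∣ a b ⟩
        ℚ.∣ a ∣ ℚ.* ℚ.∣ b ∣    ≤⟨ ℚP.*-monoʳ-≤-nonNeg ℚ.∣ b ∣ {{ℚP.∣-∣-nonNeg b}} a≤B ⟩
        B ℚ.* ℚ.∣ b ∣          <⟨ ℚP.*-monoʳ-<-pos B {{ℚ.positive 0<B}} b<δ ⟩
        B ℚ.* δ                ∎
      where open ℚP.≤-Reasoning

    quotient : ∀ B ε → 0ℚ ℚ.< B → 0ℚ ℚ.< ε → ∃[ δ ] (0ℚ ℚ.< δ × B ℚ.* δ ≡ ε)
    quotient B ε 0<B 0<ε = 1/B ℚ.* ε , 0<δ , B*δ≡ε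
      where
      1/B : ℚ
      1/B = (ℚ.1/ B) {{ℚP.pos⇒nonZero B {{ℚ.positive 0<B}}}}
      1/B-pos : ℚ.Positive 1/B
      1/B-pos = ℚP.1/pos⇒pos B {{ℚ.positive 0<B}}
      0<δ : 0ℚ ℚ.< 1/B ℚ.* ε
      0<δ = subst (ℚ._< 1/B ℚ.* ε) (ℚP.*-zeroʳ 1/B) (ℚP.*-monoʳ-<-pos 1/B {{1/B-pos}} 0<ε)
      B*δ≡ε : B ℚ.* (1/B ℚ.* ε) ≡ ε
      B*δ≡ε = trans (sym (ℚP.*-assoc B 1/B ε))
             (trans (cong (ℚ._* ε) (ℚP.*-inverseʳ B {{ℚP.pos⇒nonZero B {{ℚ.positive 0<B}}}}))
                    (ℚP.*-identityˡ ε))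

    *-close : ∀ {Bx By δ ε} a b c d → 0ℚ ℚ.< Bx → 0ℚ ℚ.< By → (Bx ℚ.+ By) ℚ.* δ ≡ ε →
              ℚ.∣ a ∣ ℚ.≤ Bx → ℚ.∣ d ∣ ℚ.≤ By → ℚ.∣ a ℚ.- c ∣ ℚ.< δ → ℚ.∣ b ℚ.- d ∣ ℚ.< δ →
              ℚ.∣ a ℚ.* b ℚ.- c ℚ.* d ∣ ℚ.< ε
    *-close {Bx} {By} {δ} {ε} a b c d 0<Bx 0<By Bδ≡ε a≤ d≤ a-c< b-d< = begin-strict
        ℚ.∣ a ℚ.* b ℚ.- c ℚ.* d ∣
          ≡⟨ cong ℚ.∣_∣ (*-regroup a b c d) ⟩
        ℚ.∣ a ℚ.* (b ℚ.- d) ℚ.+ d ℚ.* (a ℚ.- c) ∣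
          ≤⟨ ℚP.∣p+q∣≤∣p∣+∣q∣ (a ℚ.* (b ℚ.- d)) (d ℚ.* (a ℚ.- c)) ⟩
        ℚ.∣ a ℚ.* (b ℚ.- d) ∣ ℚ.+ ℚ.∣ d ℚ.* (a ℚ.- c) ∣
          <⟨ ℚP.+-mono-< (*-bound {a} {b ℚ.- d} 0<Bx a≤ b-d<) (*-bound {d} {a ℚ.- c} 0<By d≤ a-c<) ⟩
        Bx ℚ.* δ ℚ.+ By ℚ.* δ
          ≡⟨ sym (ℚP.*-distribʳ-+ δ Bx By) ⟩
        (Bx ℚ.+ By) ℚ.* δ
          ≡⟨ Bδ≡ε ⟩
        ε ∎
      where open ℚP.≤-Reasoning

    *-cauchy : ∀ x y → IsCauchy x → IsCauchy y → IsCauchy (λ n → x n ℚ.* y n)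
    *-cauchy x y cx cy ε 0<ε =
      let Bx , 0<Bx , N₁ , bx = bounded x cx
          By , 0<By , N₂ , by = bounded y cy
          δ , 0<δ , Bδ≡ε = quotient (Bx ℚ.+ By) ε (ℚP.+-mono-< 0<Bx 0<By) 0<ε
          N₃ , p = cx δ 0<δ
          N₄ , q = cy δ 0<δ
          M₁ = N₁ ℕ.⊔ N₂
          M₂ = N₃ ℕ.⊔ N₄
          from₁ = λ {m} (h : M₁ ℕ.⊔ M₂ ℕ.≤ m) → ℕP.m⊔n≤o⇒m≤o M₁ M₂ h
          from₂ = λ {m} (h : M₁ ℕ.⊔ M₂ ℕ.≤ m) → ℕP.m⊔n≤o⇒n≤o M₁ M₂ h
      in M₁ ℕ.⊔ M₂ , λ m n hm hn →
        *-close (x m) (y m) (x n) (y n) 0<Bx 0<By Bδ≡ε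
          (bx m (ℕP.m⊔n≤o⇒m≤o N₁ N₂ (from₁ hm)))
          (by n (ℕP.m⊔n≤o⇒n≤o N₁ N₂ (from₁ hn)))
          (p m n (ℕP.m⊔n≤o⇒m≤o N₃ N₄ (from₂ hm)) (ℕP.m⊔n≤o⇒m≤o N₃ N₄ (from₂ hn)))
          (q m n (ℕP.m⊔n≤o⇒n≤o N₃ N₄ (from₂ hm)) (ℕP.m⊔n≤o⇒n≤o N₃ N₄ (from₂ hn)))

infixl 6 _+ℝ_ _-ℝ_
infixl 7 _*ℝ_
infix  8 -ℝ_

fromℚ : ℚ → ℝ
fromℚ q = mkℝ (λ _ → q) (const-cauchy q)

0ℝ 1ℝ : ℝ
0ℝ = fromℚ 0ℚ
1ℝ = fromℚ 1ℚ

_+ℝ_ : ℝ → ℝ → ℝ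
x +ℝ y = mkℝ (λ n → seq x n ℚ.+ seq y n) (+-cauchy (seq x) (seq y) (cauchy x) (cauchy y))

-ℝ_ : ℝ → ℝ
-ℝ x = mkℝ (λ n → ℚ.- seq x n) (neg-cauchy (seq x) (cauchy x))

_-ℝ_ : ℝ → ℝ → ℝ
x -ℝ y = x +ℝ (-ℝ y)

_*ℝ_ : ℝ → ℝ → ℝ
x *ℝ y = mkℝ (λ n → seq x n ℚ.* seq y n) (*-cauchy (seq x) (seq y) (cauchy x) (cauchy y))

_⟶ℝ_ : (ℕ → ℝ) → ℝ → Set
s ⟶ℝ x = ∀ ε → 0ℝ <ℝ ε →
  ∃[ N ] (∀ k → N ℕ.≤ k → (s k -ℝ x <ℝ ε) × (x -ℝ s k <ℝ ε))

------------------------------------------------------------------------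
-- Complex numbers

record ℂ : Set where
  constructor _+i_
  field
    re im : ℝ
open ℂ public

infixl 6 _+ℂ_ _-ℂ_
infixl 7 _*ℂ_

fromℝ : ℝ → ℂ
fromℝ x = x +i 0ℝ

0ℂ 1ℂ iℂ : ℂ
0ℂ = fromℝ 0ℝ
1ℂ = fromℝ 1ℝ
iℂ = 0ℝ +i 1ℝ

_+ℂ_ _-ℂ_ _*ℂ_ : ℂ → ℂ → ℂ
z +ℂ w = (re z +ℝ re w) +i (im z +ℝ im w)
z -ℂ w = (re z -ℝ re w) +i (im z -ℝ im w)
z *ℂ w = (re z *ℝ re w -ℝ im z *ℝ im w) +i (re z *ℝ im w +ℝ im z *ℝ re w)

conj : ℂ → ℂ
conj z = re z +i (-ℝ im z)

∣_∣² : ℂ → ℝ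
∣ z ∣² = re z *ℝ re z +ℝ im z *ℝ im z

fromℤ : ℤ → ℂ
fromℤ k = fromℝ (fromℚ (k ℚ./ 1))

invFactorial : ℕ → ℂ
invFactorial k = fromℝ (fromℚ ((+ 1 ℚ./ (k !)) {{k ℕP.!≢0}}))

------------------------------------------------------------------------
-- Vectors and matrices

Matrix : Set → ℕ → Set
Matrix A n = Fin n → Fin n → A

∑ℝ : ∀ {n} → Vector ℝ n → ℝ
∑ℝ = foldr _+ℝ_ 0ℝ

∑ℂ : ∀ {n} → Vector ℂ n → ℂ
∑ℂ = foldr _+ℂ_ 0ℂ

module _ {n : ℕ} where

  I : Matrix ℂ n
  I i j = if ⌊ i Fin.≟ j ⌋ then 1ℂ else 0ℂ

  𝐞 : Fin n → Vector ℂ n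
  𝐞 u v = if ⌊ u Fin.≟ v ⌋ then 1ℂ else 0ℂ

  𝟏 : Vector ℂ n
  𝟏 _ = 1ℂ

  _·_ : ℂ → Matrix ℂ n → Matrix ℂ n
  (c · A) i j = c *ℂ A i j

  _⊗_ : Matrix ℂ n → Matrix ℂ n → Matrix ℂ n
  (A ⊗ B) i j = ∑ℂ (λ k → A i k *ℂ B k j)

  _⊛_ : Matrix ℂ n → Vector ℂ n → Vector ℂ n
  (A ⊛ x) i = ∑ℂ (λ k → A i k *ℂ x k)

  conjMatrix : Matrix ℂ n → Matrix ℂ n
  conjMatrix A i j = conj (A i j)

  _^ᴹ_ : Matrix ℂ n → ℕ → Matrix ℂ n
  A ^ᴹ zero  = I
  A ^ᴹ suc k = A ⊗ (A ^ᴹ k)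

  _∘ᵛ_ _-ᵛ_ : Vector ℂ n → Vector ℂ n → Vector ℂ n
  (x ∘ᵛ y) i = x i *ℂ y i
  (x -ᵛ y) i = x i -ℂ y i

  _·ᵛ_ : ℂ → Vector ℂ n → Vector ℂ n
  (c ·ᵛ x) i = c *ℂ x i

  expPartialSum : Matrix ℂ n → ℕ → Matrix ℂ n
  expPartialSum A N i j = ∑ℂ {N} (λ k → invFactorial (Fin.toℕ k) *ℂ (A ^ᴹ Fin.toℕ k) i j)

  -- E = e^A: the series ∑ₖ Aᵏ / k! converges to E.
  IsExp : Matrix ℂ n → Matrix ℂ n → Set
  IsExp A E = ∀ i j → ((λ N → re (expPartialSum A N i j)) ⟶ℝ re (E i j))
                    × ((λ N → im (expPartialSum A N i j)) ⟶ℝ im (E i j))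

  -- r = ‖x‖ (Euclidean): r is the nonnegative square root of ∑ⱼ ∣xⱼ∣².
  IsNorm : Vector ℂ n → ℝ → Set
  IsNorm x r = (0ℝ ≤ℝ r) × (r *ℝ r ≈ℝ ∑ℝ (λ j → ∣ x j ∣²))

------------------------------------------------------------------------
-- Graphs: finite, simple, undirected, connected, unweighted

record Graph (n : ℕ) : Set₁ where
  field
    Adj       : Rel (Fin n) 0ℓ
    adj?      : Decidable Adj
    symmetric : Symmetric Adj
    loopless  : Irreflexive _≡_ Adj
    connected : ∀ u v → Star Adj u v

module _ {n : ℕ} (X : Graph n) where
  open Graph X

  edges : List (Fin n × Fin n)
  edges = filter (λ (u , v) → (u Fin.<? v) ×-dec adj? u v) (cartesianProduct (allFin n) (allFin n))

  ∣E∣ : ℕ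
  ∣E∣ = length edges

  deg : Fin n → ℕ
  deg u = length (filter (adj? u) (allFin n))

  maxDeg : ℕ
  maxDeg = max 0 (map deg (allFin n))

  avgDeg : .{{NonZero n}} → ℚ
  avgDeg = + (2 ℕ.* ∣E∣) ℚ./ n

  adjacency degreeMatrix laplacian signlessLaplacian : Matrix ℤ n
  adjacency u v         = if ⌊ adj? u v ⌋ then + 1 else + 0
  degreeMatrix u v      = if ⌊ u Fin.≟ v ⌋ then + deg u else + 0
  laplacian u v         = degreeMatrix u v ℤ.- adjacency u v
  signlessLaplacian u v = degreeMatrix u v ℤ.+ adjacency u v

------------------------------------------------------------------------
-- ε-uniform mixing

module _ {n : ℕ} .{{_ : NonZero n}} where

  -- U = U(t) = e^{itM}
  IsTransition : Matrix ℤ n → ℝ → Matrix ℂ n → Set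
  IsTransition M t U = IsExp ((iℂ *ℂ fromℝ t) · (λ i j → fromℤ (M i j))) U

  deviation : Matrix ℂ n → Fin n → Vector ℂ n
  deviation U u = ((U ⊛ 𝐞 u) ∘ᵛ (conjMatrix U ⊛ 𝐞 u)) -ᵛ (fromℝ (fromℚ (+ 1 ℚ./ n)) ·ᵛ 𝟏)

  DeviationBelow : ℝ → Matrix ℂ n → Fin n → Set
  DeviationBelow ε U u = ∃[ r ] (IsNorm (deviation U u) r × r <ℝ ε)

  LocalεUniformMixing : Matrix ℤ n → Fin n → Set
  LocalεUniformMixing M u = ∀ ε → 0ℝ <ℝ ε →
    ∃[ τ ] ∃[ U ] (IsTransition M τ U × DeviationBelow ε U u)

  εUniformMixing : Matrix ℤ n → Set
  εUniformMixing M = ∀ ε → 0ℝ <ℝ ε →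
    ∃[ τ ] ∃[ U ] (IsTransition M τ U × (∀ u → DeviationBelow ε U u))

{-# OPTIONS --safe #-}

-- The energy ⟨x, M x⟩ of x = U(t) e_u is independent of t, hence equal to M_uu = deg u, while
-- ⟨x, M x⟩ ≤ 2 ∑_v deg v |x_v|² because 2 |x_v x_w| ≤ |x_v|² + |x_w|² on every edge.  Under
-- ε-uniform mixing |x_v|² is close to 1/n, so the right-hand side is close to 2 d̄.
--
-- Conservation of energy is proved quantitatively for the truncated series
-- y = ∑_{k ≤ K} (iτ)^k/k! M^k e_u with τ rational: ⟨y, M y⟩ telescopes to M_uu up to a single sum
-- that tends to 0 as K → ∞.  Fixing first K and then one late index of all Cauchy sequences
-- involved turns the whole comparison into an inequality between rationals.
module Submission where

open import Defs
open import Algebra.Bundles using (CommutativeRing)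
open import Data.Bool using (if_then_else_)
open import Data.Nat as ℕ using (ℕ; zero; suc; NonZero; _!)
import Data.Nat.Properties as ℕP
open import Data.Integer as ℤ using (ℤ; +_)
import Data.Integer.Properties as ℤP
open import Data.Rational using (ℚ; 0ℚ; 1ℚ; ½; _+_; _*_; _-_; -_; _/_; _≤_; _<_; ∣_∣; 1/_; ↥_; ↧ₙ_; toℚᵘ; positive; nonNegative)
open import Data.Rational.Properties
import Data.Rational.Unnormalised as ℚᵘ
import Data.Rational.Unnormalised.Properties as ℚᵘP
open import Data.Rational.Solver using (module +-*-Solver)
open import Data.Fin as Fin using (Fin; zero; suc; toℕ)
import Data.Fin.Properties as FinP
open import Data.List as List using (List; _∷_; length; filter; cartesianProduct)
open import Data.List.Extrema.Nat using (argmax-all)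
import Data.List.Properties as ListP
import Data.List.Relation.Unary.All.Properties as All
open import Data.Product using (∃-syntax; _×_; _,_; proj₁; proj₂)
open import Data.Sum as Sum using (_⊎_; inj₁; inj₂)
open import Data.Vec.Functional using (Vector)
open import Function using (_∘_; id)
open import Relation.Binary.Definitions using (tri<; tri≈; tri>)
open import Relation.Binary.PropositionalEquality using (_≡_; _≢_; refl; sym; trans; cong; cong₂; subst; module ≡-Reasoning)
open import Relation.Nullary using (¬_; Dec; yes; no; contradiction)
open import Relation.Nullary.Decidable using (⌊_⌋; _×-dec_)
open import Relation.Unary using (Decidable)
open import Algebra.Properties.Semiring.Sum (CommutativeRing.semiring +-*-commutativeRing) using (sum; sum-cong-≗; ∑-distrib-+; ∑-comm; *-distribˡ-sum; *-distribʳ-sum)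
open import Algebra.Properties.CommutativeSemiring.Exp (CommutativeRing.commutativeSemiring +-*-commutativeRing) using (_^_; ^-homo-*; ^-distrib-*)
open +-*-Solver using (solve; con; _:+_; _:*_; :-_; _:-_; _:=_)

-- Rational arithmetic and finite sums

-- Real operations act termwise on Cauchy sequences, so the `N`-th entries of the partial sums of
-- the matrix exponential are exactly the truncated series at the rational time `τ = seq t N`, with
-- no error term. The order of choices shapes the proof. Closeness of a partial sum to `U` at index
-- `N` is known only beyond a threshold depending on `K`, so `K` has to precede `N`, while `τ`
-- varies with `N`. The truncation error is therefore estimated uniformly for all `τ` with absolute
-- value at most `B`, where `B` bounds the late entries of `t`. The error is explicit. By symmetry
-- of `M` the coefficient attached to orders `j` and `k` depends on `j + k` alone, so the double
-- series is organised by antidiagonals. Those contained in the square of orders up to `K` cancel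
-- for `j + k > 0`, as in the product of the series of e^(-z) and e^z; those cut off by the square
-- leave the border sum. The two sides of the final inequality depend neither on `K` nor on `N`, so
-- one good pair `K`, `N` per tolerance suffices.

fromℕ : ℕ → ℚ
fromℕ k = + k / 1

/1-+ : ∀ i j → (i ℤ.+ j) / 1 ≡ i / 1 + j / 1
/1-+ i j = toℚᵘ-injective (begin
  toℚᵘ ((i ℤ.+ j) / 1)          ≈⟨ toℚᵘ-fromℚᵘ (ℚᵘ.mkℚᵘ (i ℤ.+ j) 0) ⟩
  ℚᵘ.mkℚᵘ (i ℤ.+ j) 0
    ≈⟨ ℚᵘ.*≡* (cong (ℤ._* + 1) (cong₂ ℤ._+_ (sym (ℤP.*-identityʳ i)) (sym (ℤP.*-identityʳ j)))) ⟩
  ℚᵘ.mkℚᵘ i 0 ℚᵘ.+ ℚᵘ.mkℚᵘ j 0    ≈⟨ ℚᵘP.+-cong (toℚᵘ-fromℚᵘ (ℚᵘ.mkℚᵘ i 0)) (toℚᵘ-fromℚᵘ (ℚᵘ.mkℚᵘ j 0)) ⟨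
  toℚᵘ (i / 1) ℚᵘ.+ toℚᵘ (j / 1) ≈⟨ toℚᵘ-homo-+ (i / 1) (j / 1) ⟨
  toℚᵘ (i / 1 + j / 1)           ∎)
  where open ℚᵘP.≃-Reasoning

/1-neg : ∀ i → (ℤ.- i) / 1 ≡ - (i / 1)
/1-neg i = toℚᵘ-injective (begin
  toℚᵘ ((ℤ.- i) / 1)   ≈⟨ toℚᵘ-fromℚᵘ (ℚᵘ.mkℚᵘ (ℤ.- i) 0) ⟩
  ℚᵘ.- ℚᵘ.mkℚᵘ i 0      ≈⟨ ℚᵘP.-‿cong (toℚᵘ-fromℚᵘ (ℚᵘ.mkℚᵘ i 0)) ⟨
  ℚᵘ.- toℚᵘ (i / 1)     ≈⟨ toℚᵘ-homo‿- (i / 1) ⟨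
  toℚᵘ (- (i / 1))      ∎)
  where open ℚᵘP.≃-Reasoning

/-*ˡ : ∀ i k .{{_ : ℕ.NonZero k}} → (i / 1) * (+ 1 / k) ≡ i / k
/-*ˡ i k@(suc k-1) = toℚᵘ-injective (begin
  toℚᵘ ((i / 1) * (+ 1 / k))          ≈⟨ toℚᵘ-homo-* (i / 1) (+ 1 / k) ⟩
  toℚᵘ (i / 1) ℚᵘ.* toℚᵘ (+ 1 / k)    ≈⟨ ℚᵘP.*-cong (toℚᵘ-fromℚᵘ (ℚᵘ.mkℚᵘ i 0)) (toℚᵘ-fromℚᵘ (ℚᵘ.mkℚᵘ (+ 1) k-1)) ⟩
  ℚᵘ.mkℚᵘ i 0 ℚᵘ.* ℚᵘ.mkℚᵘ (+ 1) k-1  ≈⟨ ℚᵘ.*≡* (cong₂ ℤ._*_ (ℤP.*-identityʳ i) (sym (ℤP.*-identityˡ (+ k)))) ⟩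
  ℚᵘ.mkℚᵘ i k-1                       ≈⟨ toℚᵘ-fromℚᵘ (ℚᵘ.mkℚᵘ i k-1) ⟨
  toℚᵘ (i / k)                        ∎)
  where open ℚᵘP.≃-Reasoning

/-cancel : ∀ m k .{{_ : ℕ.NonZero m}} .{{_ : ℕ.NonZero k}} .{{_ : ℕ.NonZero (m ℕ.* k)}} →
           + m / (m ℕ.* k) ≡ + 1 / k
/-cancel m@(suc _) k@(suc k-1) = fromℚᵘ-cong {ℚᵘ.mkℚᵘ (+ m) _} {ℚᵘ.mkℚᵘ (+ 1) k-1}
  (ℚᵘ.*≡* (trans (ℤP.pos-* m k) (sym (ℤP.*-identityˡ _))))

fromℕ-suc : ∀ k → fromℕ (suc k) ≡ 1ℚ + fromℕ k
fromℕ-suc k = /1-+ (+ 1) (+ k)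

fromℕ-+ : ∀ j k → fromℕ (j ℕ.+ k) ≡ fromℕ j + fromℕ k
fromℕ-+ j k = /1-+ (+ j) (+ k)

fromℕ-nonNeg : ∀ k → 0ℚ ≤ fromℕ k
fromℕ-nonNeg k = nonNegative⁻¹ (fromℕ k) {{normalize-nonNeg k 1}}

fromℕ-mono : ∀ {j k} → j ℕ.≤ k → fromℕ j ≤ fromℕ k
fromℕ-mono {j} {k} j≤k = subst (fromℕ j ≤_)
  (trans (sym (fromℕ-+ j (k ℕ.∸ j))) (cong fromℕ (ℕP.m+[n∸m]≡n j≤k)))
  (subst (_≤ fromℕ j + fromℕ (k ℕ.∸ j)) (+-identityʳ _) (+-monoʳ-≤ (fromℕ j) (fromℕ-nonNeg (k ℕ.∸ j))))

1≤fromℕ-suc : ∀ k → 1ℚ ≤ fromℕ (suc k)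
1≤fromℕ-suc k = fromℕ-mono {1} {suc k} (ℕ.s≤s ℕ.z≤n)

≤-by-difference : ∀ {x y} z → 0ℚ ≤ z → y ≡ x + z → x ≤ y
≤-by-difference {x} z 0≤z refl = subst (_≤ x + z) (+-identityʳ x) (+-monoʳ-≤ x 0≤z)

+-nonNeg : ∀ {p q} → 0ℚ ≤ p → 0ℚ ≤ q → 0ℚ ≤ p + q
+-nonNeg 0≤p 0≤q = +-mono-≤ 0≤p 0≤q

*-nonNeg : ∀ {p q} → 0ℚ ≤ p → 0ℚ ≤ q → 0ℚ ≤ p * q
*-nonNeg {p} {q} 0≤p 0≤q =
  nonNegative⁻¹ (p * q) {{nonNeg*nonNeg⇒nonNeg p {{nonNegative 0≤p}} q {{nonNegative 0≤q}}}}

*-monoʳ : ∀ {p q} r → 0ℚ ≤ r → p ≤ q → r * p ≤ r * q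
*-monoʳ r 0≤r = *-monoˡ-≤-nonNeg r {{nonNegative 0≤r}}

*-monoˡ : ∀ {p q} r → 0ℚ ≤ r → p ≤ q → p * r ≤ q * r
*-monoˡ r 0≤r = *-monoʳ-≤-nonNeg r {{nonNegative 0≤r}}

*-mono : ∀ {a b c d} → 0ℚ ≤ b → 0ℚ ≤ c → a ≤ b → c ≤ d → a * c ≤ b * d
*-mono {b = b} {c} 0≤b 0≤c a≤b c≤d = ≤-trans (*-monoˡ c 0≤c a≤b) (*-monoʳ b 0≤b c≤d)

square-nonNeg : ∀ p → 0ℚ ≤ p * p
square-nonNeg p with ≤-total 0ℚ p
... | inj₁ 0≤p = *-nonNeg 0≤p 0≤p
... | inj₂ p≤0 = subst (0ℚ ≤_) (solve 1 (λ p → (:- p) :* (:- p) := p :* p) refl p)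
                   (*-nonNeg (neg-antimono-≤ p≤0) (neg-antimono-≤ p≤0))

square-cancel-≤ : ∀ {p q} → 0ℚ ≤ q → p * p ≤ q * q → p ≤ q
square-cancel-≤ {p} {q} 0≤q p²≤q² = ≮⇒≥ λ q<p →
  <-irrefl refl (<-≤-trans (≤-<-trans (*-monoʳ q 0≤q (<⇒≤ q<p))
    (*-monoˡ-<-pos p {{positive (≤-<-trans 0≤q q<p)}} q<p)) p²≤q²)

p≤∣p∣ : ∀ p → p ≤ ∣ p ∣
p≤∣p∣ p with ≤-total 0ℚ p
... | inj₁ 0≤p = ≤-reflexive (sym (0≤p⇒∣p∣≡p 0≤p))
... | inj₂ p≤0 = ≤-trans p≤0 (0≤∣p∣ p)

∣p∣≤ : ∀ {p b} → p ≤ b → - p ≤ b → ∣ p ∣ ≤ b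
∣p∣≤ {p} p≤b -p≤b with ∣p∣≡p∨∣p∣≡-p p
... | inj₁ eq = subst (_≤ _) (sym eq) p≤b
... | inj₂ eq = subst (_≤ _) (sym eq) -p≤b

∣*∣≤ : ∀ {a b c d} → ∣ a ∣ ≤ b → ∣ c ∣ ≤ d → ∣ a * c ∣ ≤ b * d
∣*∣≤ {a} {c = c} a≤b c≤d = ≤-trans (≤-reflexive (∣p*q∣≡∣p∣*∣q∣ a c))
  (*-mono (≤-trans (0≤∣p∣ a) a≤b) (0≤∣p∣ c) a≤b c≤d)

≤-from-approx : ∀ {p q} → (∀ δ → 0ℚ < δ → p ≤ q + δ) → p ≤ q
≤-from-approx {p} {q} h = ≮⇒≥ λ q<p →
  let m , q<m , m<p = <-dense q<p in
  <-irrefl refl (<-≤-trans m<p (subst (p ≤_) (solve 2 (λ q m → q :+ (m :- q) := m) refl q m)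
    (h (m - q) (subst (_< m - q) (+-inverseʳ q) (+-monoˡ-< (- q) q<m)))))

divide : ∀ b ε → 0ℚ < b → 0ℚ < ε → ∃[ δ ] (0ℚ < δ × b * δ ≡ ε)
divide b ε 0<b 0<ε = 1/b * ε , 0<δ , bδ≡ε
  where
  instance
    b-pos = positive 0<b
    b≢0 = pos⇒nonZero b
  1/b = 1/ b
  0<δ = positive⁻¹ (1/b * ε) {{pos*pos⇒pos 1/b {{1/pos⇒pos b}} ε {{positive 0<ε}}}}
  bδ≡ε = trans (sym (*-assoc b 1/b ε)) (trans (cong (_* ε) (*-inverseʳ b)) (*-identityˡ ε))

-- Index shift: recip k = 1/(k+1).
recip : ℕ → ℚ
recip k = + 1 / suc k

recip-inverse : ∀ k → fromℕ (suc k) * recip k ≡ 1ℚ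
recip-inverse k = trans (/-*ˡ (+ suc k) (suc k))
     (subst (λ d → {{_ : ℕ.NonZero d}} → + suc k / d ≡ 1ℚ) (ℕP.*-identityʳ (suc k)) (/-cancel (suc k) 1))

recip-nonNeg : ∀ k → 0ℚ ≤ recip k
recip-nonNeg k = nonNegative⁻¹ (recip k) {{normalize-nonNeg 1 (suc k)}}

recip≤1 : ∀ k → recip k ≤ 1ℚ
recip≤1 k = begin
  recip k                  ≡⟨ sym (*-identityˡ _) ⟩
  1ℚ * recip k             ≤⟨ *-monoˡ (recip k) (recip-nonNeg k) (1≤fromℕ-suc k) ⟩
  fromℕ (suc k) * recip k  ≡⟨ recip-inverse k ⟩
  1ℚ ∎
  where open ≤-Reasoning

1/n≤1 : ∀ n .{{_ : ℕ.NonZero n}} → + 1 / n ≤ 1ℚ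
1/n≤1 (suc n) = recip≤1 n

-- The absolute value of the numerator is a witness, because the denominator is at least 1.
archimedean : ∀ q → ∃[ k ] q ≤ fromℕ k
archimedean q = ℤ.∣ ↥ q ∣ , (begin
  q              ≡⟨ trans (sym (↥p/↧p≡p q)) (sym (/-*ˡ (↥ q) (↧ₙ q))) ⟩
  (↥ q / 1) * w  ≤⟨ *-monoʳ-≤-nonNeg w {{normalize-nonNeg 1 (↧ₙ q)}} (num≤ (↥ q)) ⟩
  N * w          ≤⟨ *-monoˡ-≤-nonNeg N {{normalize-nonNeg ℤ.∣ ↥ q ∣ 1}} (1/n≤1 (↧ₙ q)) ⟩
  N * 1ℚ         ≡⟨ *-identityʳ N ⟩
  N              ∎)
  where
  open ≤-Reasoning
  w N : ℚ
  w = + 1 / ↧ₙ q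
  N = fromℕ ℤ.∣ ↥ q ∣
  num≤ : ∀ i → i / 1 ≤ fromℕ ℤ.∣ i ∣
  num≤ (+ k) = ≤-refl
  num≤ i@(ℤ.-[1+ k ]) = ≤-trans (≤-trans (≤-reflexive (/1-neg (+ suc k))) (neg-antimono-≤ (fromℕ-nonNeg (suc k))))
       (fromℕ-nonNeg (suc k))

+-congˡ : ∀ x {y z} → y ≡ z → x + y ≡ x + z
+-congˡ x = cong (λ y → x + y)

sum-nonNeg : ∀ {n} (f : Vector ℚ n) → (∀ i → 0ℚ ≤ f i) → 0ℚ ≤ sum f
sum-nonNeg {zero}  f h = ≤-refl
sum-nonNeg {suc n} f h = +-nonNeg (h zero) (sum-nonNeg (f ∘ suc) (h ∘ suc))

sum-mono : ∀ {n} (f g : Vector ℚ n) → (∀ i → f i ≤ g i) → sum f ≤ sum g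
sum-mono {zero}  f g h = ≤-refl
sum-mono {suc n} f g h = +-mono-≤ (h zero) (sum-mono (f ∘ suc) (g ∘ suc) (h ∘ suc))

sum-abs : ∀ {n} (f g : Vector ℚ n) → (∀ i → ∣ f i ∣ ≤ g i) → ∣ sum f ∣ ≤ sum g
sum-abs {zero}  f g h = ≤-refl
sum-abs {suc n} f g h = ≤-trans (∣p+q∣≤∣p∣+∣q∣ (f zero) (sum (f ∘ suc)))
  (+-mono-≤ (h zero) (sum-abs (f ∘ suc) (g ∘ suc) (h ∘ suc)))

term≤sum : ∀ {n} (f : Vector ℚ n) → (∀ i → 0ℚ ≤ f i) → ∀ i → f i ≤ sum f
term≤sum f h zero    = ≤-by-difference (sum (f ∘ suc)) (sum-nonNeg _ (h ∘ suc)) refl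
term≤sum f h (suc i) = ≤-trans (term≤sum (f ∘ suc) (h ∘ suc) i)
  (≤-by-difference (f zero) (h zero) (+-comm (f zero) _))

sum-zero : ∀ {n} (f : Vector ℚ n) → (∀ i → f i ≡ 0ℚ) → sum f ≡ 0ℚ
sum-zero {zero}  f h = refl
sum-zero {suc n} f h = trans (cong₂ _+_ (h zero) (sum-zero (f ∘ suc) (h ∘ suc))) (+-identityˡ 0ℚ)

sum-single : ∀ {n} (f : Vector ℚ n) u → (∀ i → u ≢ i → f i ≡ 0ℚ) → sum f ≡ f u
sum-single f zero    h = trans (+-congˡ (f zero) (sum-zero _ λ i → h (suc i) λ ())) (+-identityʳ _)
sum-single f (suc u) h = trans (cong₂ _+_ (h zero λ ())
  (sum-single (f ∘ suc) u λ i u≢i → h (suc i) λ { refl → u≢i refl })) (+-identityˡ _)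

sum-neg : ∀ {n} (f : Vector ℚ n) → sum (λ i → - f i) ≡ - sum f
sum-neg {zero}  f = refl
sum-neg {suc n} f = trans (+-congˡ (- f zero) (sum-neg (f ∘ suc)))
  (sym (neg-distrib-+ (f zero) (sum (f ∘ suc))))

∑< : ℕ → (ℕ → ℚ) → ℚ
∑< K f = sum {K} (f ∘ toℕ)

∑<-last : ∀ K f → ∑< (suc K) f ≡ ∑< K f + f K
∑<-last zero    f = +-comm (f 0) 0ℚ
∑<-last (suc K) f = trans (+-congˡ (f 0) (∑<-last K (f ∘ suc))) (sym (+-assoc (f 0) _ _))

-- Truncated exponential series

∑<-telescope : ∀ K (A : ℕ → ℚ) → ∑< K (λ j → A j - A (suc j)) ≡ A 0 - A K
∑<-telescope zero    A = sym (+-inverseʳ (A 0))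
∑<-telescope (suc K) A = trans (+-congˡ (A 0 - A 1) (∑<-telescope K (A ∘ suc)))
  (solve 3 (λ a b c → (a :- b) :+ (b :- c) := a :- c) refl (A 0) (A 1) (A (suc K)))

-- With `A j = ∑< K (h j)`, row `j + 1` of `g` sums to `A j - A (suc j)` plus the right border entry
-- `h j K`, and row 0 sums to `g 0 0 - A 0`. Adding the rows telescopes to `- A K` at the bottom
-- border, and antisymmetry turns the right border into a second `- A K`.
grid-telescope : ∀ (g h : ℕ → ℕ → ℚ) →
  (∀ j → g (suc j) 0 ≡ h j 0) →
  (∀ k → g 0 (suc k) ≡ - h 0 k) →
  (∀ j k → g (suc j) (suc k) ≡ h j (suc k) - h (suc j) k) →
  (∀ j k → h j k ≡ - h k j) →
  ∀ K → ∑< (suc K) (λ j → ∑< (suc K) (g j)) ≡ g 0 0 - (∑< K (h K) + ∑< K (h K))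
grid-telescope g h left top inner anti K = begin
  ∑< (suc K) (g 0) + ∑< K (λ j → ∑< (suc K) (g (suc j)))
    ≡⟨ cong₂ _+_ row₀ (sum-cong-≗ {K} (row ∘ toℕ)) ⟩
  (g 0 0 - A 0) + ∑< K (λ j → (A j - A (suc j)) + h j K)
    ≡⟨ +-congˡ (g 0 0 - A 0) (∑-distrib-+ {K} _ _) ⟩
  (g 0 0 - A 0) + (∑< K (λ j → A j - A (suc j)) + ∑< K (λ j → h j K))
    ≡⟨ +-congˡ (g 0 0 - A 0) (cong₂ _+_ (∑<-telescope K A)
         (trans (sum-cong-≗ {K} (λ j → anti (toℕ j) K)) (sum-neg {K} _))) ⟩
  (g 0 0 - A 0) + ((A 0 - A K) + - A K)
    ≡⟨ solve 3 (λ g a b → (g :- a) :+ ((a :- b) :+ :- b) := g :- (b :+ b)) refl (g 0 0) (A 0) (A K) ⟩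
  g 0 0 - (A K + A K) ∎
  where
  open ≡-Reasoning
  A : ℕ → ℚ
  A j = ∑< K (h j)
  row₀ : ∑< (suc K) (g 0) ≡ g 0 0 - A 0
  row₀ = +-congˡ (g 0 0) (trans (sum-cong-≗ {K} (top ∘ toℕ)) (sum-neg {K} _))
  row : ∀ j → ∑< (suc K) (g (suc j)) ≡ (A j - A (suc j)) + h j K
  row j = begin
    g (suc j) 0 + ∑< K (λ k → g (suc j) (suc k))
      ≡⟨ cong₂ _+_ (left j) (trans (sum-cong-≗ {K} (inner j ∘ toℕ)) (∑-distrib-+ {K} _ _)) ⟩
    h j 0 + (∑< K (λ k → h j (suc k)) + ∑< K (λ k → - h (suc j) k))
      ≡⟨ cong (λ z → h j 0 + (∑< K (λ k → h j (suc k)) + z)) (sum-neg {K} _) ⟩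
    h j 0 + (∑< K (λ k → h j (suc k)) - A (suc j))
      ≡⟨ sym (+-assoc (h j 0) _ _) ⟩
    ∑< (suc K) (h j) - A (suc j)
      ≡⟨ cong (_- A (suc j)) (∑<-last K (h j)) ⟩
    (A j + h j K) - A (suc j)
      ≡⟨ solve 3 (λ a b c → (a :+ b) :- c := (a :- c) :+ b) refl (A j) (h j K) (A (suc j)) ⟩
    (A j - A (suc j)) + h j K ∎

1/! : ℕ → ℚ
1/! k = (+ 1 / (k !)) {{k ℕP.!≢0}}

1/!-suc : ∀ k → fromℕ (suc k) * 1/! (suc k) ≡ 1/! k
1/!-suc k = trans (/-*ˡ (+ suc k) (suc k !) {{suc k ℕP.!≢0}})
                  (/-cancel (suc k) (k !) {{_}} {{k ℕP.!≢0}} {{suc k ℕP.!≢0}})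

1/!-nonNeg : ∀ k → 0ℚ ≤ 1/! k
1/!-nonNeg k = nonNegative⁻¹ (1/! k) {{normalize-nonNeg 1 (k !) {{k ℕP.!≢0}}}}

module ExpCoefficients (τ : ℚ) where

  -- (iτ)^k = re^ k + i im^ k and (iτ)^k/k! = α k + i β k; with a = α + i β, G j k and H j k are the
  -- real and imaginary parts of conj (a j) a k.
  re^ im^ : ℕ → ℚ
  re^ zero    = 1ℚ
  re^ (suc k) = - (τ * im^ k)
  im^ zero    = 0ℚ
  im^ (suc k) = τ * re^ k

  α β : ℕ → ℚ
  α k = 1/! k * re^ k
  β k = 1/! k * im^ k

  α-suc : ∀ k → fromℕ (suc k) * α (suc k) ≡ - (τ * β k)
  α-suc k = trans (sym (*-assoc (fromℕ (suc k)) (1/! (suc k)) (re^ (suc k))))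
    (trans (cong (_* re^ (suc k)) (1/!-suc k))
      (solve 3 (λ f t q → f :* (:- (t :* q)) := :- (t :* (f :* q))) refl (1/! k) τ (im^ k)))

  β-suc : ∀ k → fromℕ (suc k) * β (suc k) ≡ τ * α k
  β-suc k = trans (sym (*-assoc (fromℕ (suc k)) (1/! (suc k)) (im^ (suc k))))
    (trans (cong (_* im^ (suc k)) (1/!-suc k))
      (solve 3 (λ f t q → f :* (t :* q) := t :* (f :* q)) refl (1/! k) τ (re^ k)))

  G H : ℕ → ℕ → ℚ
  G j k = α j * α k + β j * β k
  H j k = α j * β k - β j * α k

  -- The recursion `(j + 1) a (j + 1) = iτ a j`, conjugated, puts the factor `-iτ` in front of
  -- `conj (a j) a k = G j k + i H j k`, and the real part of that product is `τ * H j k`.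
  G-sucˡ : ∀ j k → fromℕ (suc j) * G (suc j) k ≡ τ * H j k
  G-sucˡ j k = begin
    N * (α (suc j) * α k + β (suc j) * β k)
      ≡⟨ solve 5 (λ N a b x y → N :* (a :* x :+ b :* y) := (N :* a) :* x :+ (N :* b) :* y)
           refl N (α (suc j)) (β (suc j)) (α k) (β k) ⟩
    (N * α (suc j)) * α k + (N * β (suc j)) * β k
      ≡⟨ cong₂ (λ x y → x * α k + y * β k) (α-suc j) (β-suc j) ⟩
    (- (τ * β j)) * α k + (τ * α j) * β k
      ≡⟨ solve 5 (λ t a b x y → (:- (t :* b)) :* x :+ (t :* a) :* y := t :* (a :* y :- b :* x))
           refl τ (α j) (β j) (α k) (β k) ⟩
    τ * H j k ∎
    where
    open ≡-Reasoning
    N = fromℕ (suc j)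

  G-comm : ∀ j k → G j k ≡ G k j
  G-comm j k = cong₂ _+_ (*-comm (α j) (α k)) (*-comm (β j) (β k))

  H-anti : ∀ j k → H j k ≡ - H k j
  H-anti j k = solve 4 (λ a b x y → a :* y :- b :* x := :- (x :* b :- y :* a)) refl (α j) (β j) (α k) (β k)

  G-sucʳ : ∀ j k → fromℕ (suc k) * G j (suc k) ≡ - (τ * H j k)
  G-sucʳ j k = begin
    fromℕ (suc k) * G j (suc k)  ≡⟨ cong (fromℕ (suc k) *_) (G-comm j (suc k)) ⟩
    fromℕ (suc k) * G (suc k) j  ≡⟨ G-sucˡ k j ⟩
    τ * H k j                    ≡⟨ cong (τ *_) (H-anti k j) ⟩
    τ * - H j k                  ≡⟨ sym (neg-distribʳ-* τ (H j k)) ⟩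
    - (τ * H j k)                ∎
    where open ≡-Reasoning

  -- By G-sucˡ and G-sucʳ, (j + k) G j k = τ (H (j-1) k - H j (k-1)), which makes ∑ m (j + k) G j k
  -- telescope along antidiagonals; antisymmetry of H folds the two remaining borders into one.
  module _ (m : ℕ → ℚ) where

    -- Indexed by the total order of `H`, which is one less than that of the entry of `G` it
    -- accounts for: hence `m (suc p)` and division by `p + 1`.
    weight : ℕ → ℚ
    weight p = τ * m (suc p) * recip p

    boundary : ℕ → ℕ → ℚ
    boundary j k = weight (j ℕ.+ k) * H j k

    private
      scale : ∀ p {x y} → fromℕ (suc p) * x ≡ τ * y →
              m (suc p) * x ≡ weight p * y
      scale p {x} {y} Nx≡τy = begin
        m (suc p) * x                    ≡⟨ cong (m (suc p) *_) (sym (*-identityˡ x)) ⟩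
        m (suc p) * (1ℚ * x)             ≡⟨ cong (λ z → m (suc p) * (z * x)) (sym (recip-inverse p)) ⟩
        m (suc p) * ((N * recip p) * x)
          ≡⟨ solve 4 (λ m N r x → m :* ((N :* r) :* x) := m :* r :* (N :* x)) refl (m (suc p)) N (recip p) x ⟩
        m (suc p) * recip p * (N * x)    ≡⟨ cong (m (suc p) * recip p *_) Nx≡τy ⟩
        m (suc p) * recip p * (τ * y)
          ≡⟨ solve 4 (λ m r t y → m :* r :* (t :* y) := t :* m :* r :* y) refl (m (suc p)) (recip p) τ y ⟩
        τ * m (suc p) * recip p * y      ∎
        where
        open ≡-Reasoning
        N = fromℕ (suc p)

      left : ∀ j → m (suc j ℕ.+ 0) * G (suc j) 0 ≡ boundary j 0
      left j rewrite ℕP.+-identityʳ j = scale j (G-sucˡ j 0)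

      top : ∀ k → m (suc k) * G 0 (suc k) ≡ - boundary 0 k
      top k = trans (scale k (trans (G-sucʳ 0 k) (neg-distribʳ-* τ (H 0 k))))
                    (sym (neg-distribʳ-* (weight k) (H 0 k)))

      inner : ∀ j k → m (suc j ℕ.+ suc k) * G (suc j) (suc k) ≡ boundary j (suc k) - boundary (suc j) k
      inner j k rewrite ℕP.+-suc j k = trans
        (scale (suc (j ℕ.+ k)) {y = H j (suc k) - H (suc j) k} (begin
          fromℕ (suc (suc (j ℕ.+ k))) * G'   ≡⟨ cong (λ z → fromℕ z * G') (cong suc (sym (ℕP.+-suc j k))) ⟩
          fromℕ (suc j ℕ.+ suc k) * G'       ≡⟨ cong (_* G') (fromℕ-+ (suc j) (suc k)) ⟩
          (fromℕ (suc j) + fromℕ (suc k)) * G'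
            ≡⟨ *-distribʳ-+ G' (fromℕ (suc j)) (fromℕ (suc k)) ⟩
          fromℕ (suc j) * G' + fromℕ (suc k) * G'
            ≡⟨ cong₂ _+_ (G-sucˡ j (suc k)) (G-sucʳ (suc j) k) ⟩
          τ * H j (suc k) - τ * H (suc j) k
            ≡⟨ solve 3 (λ t x y → t :* x :- t :* y := t :* (x :- y)) refl τ (H j (suc k)) (H (suc j) k) ⟩
          τ * (H j (suc k) - H (suc j) k) ∎))
        (solve 3 (λ w x y → w :* (x :- y) := w :* x :- w :* y) refl
          (weight (suc (j ℕ.+ k))) (H j (suc k)) (H (suc j) k))
        where
        open ≡-Reasoning
        G' = G (suc j) (suc k)

      anti : ∀ j k → boundary j k ≡ - boundary k j
      anti j k rewrite ℕP.+-comm j k =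
        trans (cong (weight (k ℕ.+ j) *_) (H-anti j k)) (sym (neg-distribʳ-* (weight (k ℕ.+ j)) (H k j)))

    energy-telescope : ∀ K → ∑< (suc K) (λ j → ∑< (suc K) (λ k → m (j ℕ.+ k) * G j k))
      ≡ m 0 - (∑< K (boundary K) + ∑< K (boundary K))
    energy-telescope K = trans
      (grid-telescope (λ j k → m (j ℕ.+ k) * G j k) boundary left top inner anti K)
      (cong (_- (∑< K (boundary K) + ∑< K (boundary K))) (*-identityʳ (m 0)))

-- Growth and decay of exponential terms

^-nonNeg : ∀ {x} k → 0ℚ ≤ x → 0ℚ ≤ x ^ k
^-nonNeg zero    0≤x = nonNegative⁻¹ 1ℚ
^-nonNeg (suc k) 0≤x = *-nonNeg 0≤x (^-nonNeg k 0≤x)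

expTerm : ℚ → ℕ → ℚ
expTerm x k = 1/! k * x ^ k

expTerm-nonNeg : ∀ {x} k → 0ℚ ≤ x → 0ℚ ≤ expTerm x k
expTerm-nonNeg k 0≤x = *-nonNeg (1/!-nonNeg k) (^-nonNeg k 0≤x)

expTerm-suc : ∀ x k → fromℕ (suc k) * expTerm x (suc k) ≡ x * expTerm x k
expTerm-suc x k = trans (sym (*-assoc (fromℕ (suc k)) (1/! (suc k)) (x ^ suc k)))
  (trans (cong (_* x ^ suc k) (1/!-suc k))
    (solve 3 (λ f x y → f :* (x :* y) := x :* (f :* y)) refl (1/! k) x (x ^ k)))

module _ (x : ℚ) (0≤x : 0ℚ ≤ x) where

  private
    P : ℕ → ℚ
    P K = ∑< K (expTerm x)

    -- Consecutive terms have ratio `x / (K + 1)`, which is at most one half in this range.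
    halving : ∀ K → x + x ≤ fromℕ (suc K) → expTerm x (suc K) + expTerm x (suc K) ≤ expTerm x K
    halving K 2x≤N = *-cancelˡ-≤-pos N {{normalize-pos (suc K) 1}} (begin
      N * (b' + b')            ≡⟨ *-distribˡ-+ N b' b' ⟩
      N * b' + N * b'          ≡⟨ cong₂ _+_ (expTerm-suc x K) (expTerm-suc x K) ⟩
      x * b + x * b            ≡⟨ sym (*-distribʳ-+ b x x) ⟩
      (x + x) * b              ≤⟨ *-monoˡ b (expTerm-nonNeg K 0≤x) 2x≤N ⟩
      N * b                    ∎)
      where
      open ≤-Reasoning
      N = fromℕ (suc K)
      b = expTerm x K
      b' = expTerm x (suc K)

  -- P K + 2 xᴷ/K! is nonincreasing in K as soon as 2 x ≤ K + 1.
  expPartialSum-bounded : ∃[ W ] (0ℚ ≤ W × ∃[ K₀ ] (∀ K → K₀ ℕ.≤ K →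
    ∑< K (expTerm x) ≤ W × expTerm x K ≤ W))
  expPartialSum-bounded = W , W-nonNeg , K₀ , λ K K₀≤K → subst (λ K → P K ≤ W × expTerm x K ≤ W) (ℕP.m∸n+n≡m K₀≤K) (bounds (K ℕ.∸ K₀))
    where
    K₀ = proj₁ (archimedean (x + x))
    V : ℕ → ℚ
    V K = P K + (expTerm x K + expTerm x K)
    W = V K₀
    P-nonNeg : ∀ K → 0ℚ ≤ P K
    P-nonNeg K = sum-nonNeg {K} _ λ k → expTerm-nonNeg (toℕ k) 0≤x
    W-nonNeg : 0ℚ ≤ W
    W-nonNeg = +-nonNeg (P-nonNeg K₀) (+-nonNeg (expTerm-nonNeg K₀ 0≤x) (expTerm-nonNeg K₀ 0≤x))
    V-decreasing : ∀ d → V (d ℕ.+ K₀) ≤ W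
    V-decreasing zero    = ≤-refl
    V-decreasing (suc d) = ≤-trans (begin
      P (suc K) + (b' + b')   ≡⟨ cong (_+ (b' + b')) (∑<-last K (expTerm x)) ⟩
      (P K + b) + (b' + b')   ≤⟨ +-monoʳ-≤ (P K + b) (halving K 2x≤) ⟩
      (P K + b) + b           ≡⟨ +-assoc (P K) b b ⟩
      V K                     ∎) (V-decreasing d)
      where
      open ≤-Reasoning
      K = d ℕ.+ K₀
      b = expTerm x K
      b' = expTerm x (suc K)
      2x≤ : x + x ≤ fromℕ (suc K)
      2x≤ = ≤-trans (proj₂ (archimedean (x + x))) (fromℕ-mono (ℕP.m≤n⇒m≤1+n (ℕP.m≤n+m K₀ d)))
    bounds : ∀ d → P (d ℕ.+ K₀) ≤ W × expTerm x (d ℕ.+ K₀) ≤ W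
    bounds d = ≤-trans (≤-by-difference (b + b) (+-nonNeg 0≤b 0≤b) refl) (V-decreasing d)
             , ≤-trans (≤-by-difference (P K + b) (+-nonNeg (P-nonNeg K) 0≤b)
                 (solve 2 (λ p b → p :+ (b :+ b) := b :+ (p :+ b)) refl (P K) b)) (V-decreasing d)
      where
      K = d ℕ.+ K₀
      b = expTerm x K
      0≤b = expTerm-nonNeg K 0≤x

  -- Boundedness of terms and partial sums by `W` is enough: one step of the recursion writes the
  -- term of order `K + 1` as `x / (K + 1)` times a bounded term, and the factor `1 / (K + 1)` beats
  -- every constant. This is why the threshold is a successor.
  expTerm-vanishes : ∀ A θ → 0ℚ ≤ A → 0ℚ < θ →
    ∃[ K₀ ] (∀ K → K₀ ℕ.≤ K → A * (expTerm x K * ∑< K (expTerm x)) ≤ θ)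
  expTerm-vanishes A θ 0≤A 0<θ = suc (K₁ ℕ.+ K₂) , λ { (suc K) (ℕ.s≤s K₁₂≤K) → bound K K₁₂≤K }
    where
    W = proj₁ expPartialSum-bounded
    0≤W = proj₁ (proj₂ expPartialSum-bounded)
    K₁ = proj₁ (proj₂ (proj₂ expPartialSum-bounded))
    W-bound = proj₂ (proj₂ (proj₂ expPartialSum-bounded))
    -- The summand `1ℚ` makes the dividend strictly positive, as `divide` demands.
    quot = divide θ (1ℚ + A * (x * W * W)) 0<θ
      (+-mono-<-≤ (positive⁻¹ 1ℚ) (*-nonNeg 0≤A (*-nonNeg (*-nonNeg 0≤x 0≤W) 0≤W)))
    K₂ = proj₁ (archimedean (proj₁ quot))
    bound : ∀ K → K₁ ℕ.+ K₂ ℕ.≤ K → A * (expTerm x (suc K) * P (suc K)) ≤ θ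
    bound K K₁₂≤K = *-cancelˡ-≤-pos N {{normalize-pos (suc K) 1}} (begin
      N * (A * (b' * P (suc K)))
        ≡⟨ solve 4 (λ N A b p → N :* (A :* (b :* p)) := A :* ((N :* b) :* p)) refl N A b' (P (suc K)) ⟩
      A * ((N * b') * P (suc K))   ≡⟨ cong (λ z → A * (z * P (suc K))) (expTerm-suc x K) ⟩
      A * ((x * b) * P (suc K))    ≤⟨ *-monoʳ A 0≤A (*-mono (*-nonNeg 0≤x 0≤W)
                                        (sum-nonNeg {suc K} _ λ k → expTerm-nonNeg (toℕ k) 0≤x)
                                        (*-monoʳ x 0≤x (proj₂ (W-bound K K₁≤K)))
                                        (proj₁ (W-bound (suc K) (ℕP.m≤n⇒m≤1+n K₁≤K)))) ⟩
      A * (x * W * W)              ≤⟨ ≤-by-difference 1ℚ (nonNegative⁻¹ 1ℚ) (+-comm 1ℚ (A * (x * W * W))) ⟩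
      1ℚ + A * (x * W * W)         ≡⟨ sym (proj₂ (proj₂ quot)) ⟩
      θ * proj₁ quot               ≤⟨ *-monoʳ θ (<⇒≤ 0<θ) (≤-trans (proj₂ (archimedean (proj₁ quot))) (fromℕ-mono K₂≤)) ⟩
      θ * N                        ≡⟨ *-comm θ N ⟩
      N * θ                        ∎)
      where
      open ≤-Reasoning
      N = fromℕ (suc K)
      b = expTerm x K
      b' = expTerm x (suc K)
      K₁≤K = ℕP.m+n≤o⇒m≤o K₁ K₁₂≤K
      K₂≤ = ℕP.m≤n⇒m≤1+n (ℕP.m+n≤o⇒n≤o K₁ K₁₂≤K)

module _ (τ B C : ℚ) (0≤C : 0ℚ ≤ C) (∣τ∣≤B : ∣ τ ∣ ≤ B)
         (m : ℕ → ℚ) (∣m∣≤ : ∀ p → ∣ m p ∣ ≤ C ^ suc p) where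
  open ExpCoefficients τ

  private
    0≤B : 0ℚ ≤ B
    0≤B = ≤-trans (0≤∣p∣ τ) ∣τ∣≤B

    ∣re^∣≤ : ∀ k → ∣ re^ k ∣ ≤ B ^ k
    ∣im^∣≤ : ∀ k → ∣ im^ k ∣ ≤ B ^ k
    ∣re^∣≤ zero    = ≤-refl
    ∣re^∣≤ (suc k) = ≤-trans (≤-reflexive (∣-p∣≡∣p∣ (τ * im^ k))) (∣*∣≤ {τ} ∣τ∣≤B (∣im^∣≤ k))
    ∣im^∣≤ zero    = nonNegative⁻¹ 1ℚ
    ∣im^∣≤ (suc k) = ∣*∣≤ {τ} ∣τ∣≤B (∣re^∣≤ k)

    ∣1/!∣≤ : ∀ k → ∣ 1/! k ∣ ≤ 1/! k
    ∣1/!∣≤ k = ≤-reflexive (0≤p⇒∣p∣≡p (1/!-nonNeg k))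

    a : ℕ → ℚ
    a = expTerm B

    ∣α∣≤ : ∀ k → ∣ α k ∣ ≤ a k
    ∣α∣≤ k = ∣*∣≤ {1/! k} (∣1/!∣≤ k) (∣re^∣≤ k)
    ∣β∣≤ : ∀ k → ∣ β k ∣ ≤ a k
    ∣β∣≤ k = ∣*∣≤ {1/! k} (∣1/!∣≤ k) (∣im^∣≤ k)

    ∣H∣≤ : ∀ j k → ∣ H j k ∣ ≤ a j * a k + a j * a k
    ∣H∣≤ j k = ≤-trans (∣p-q∣≤∣p∣+∣q∣ (α j * β k) (β j * α k))
      (+-mono-≤ (∣*∣≤ {α j} (∣α∣≤ j) (∣β∣≤ k)) (∣*∣≤ {β j} (∣β∣≤ j) (∣α∣≤ k)))

    ∣weight∣≤ : ∀ p → ∣ weight m p ∣ ≤ B * C ^ suc (suc p)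
    ∣weight∣≤ p = ≤-trans (∣*∣≤ {τ * m (suc p)} {c = recip p} (∣*∣≤ {τ} ∣τ∣≤B (∣m∣≤ (suc p)))
      (≤-trans (≤-reflexive (0≤p⇒∣p∣≡p (recip-nonNeg p))) (recip≤1 p))) (≤-reflexive (*-identityʳ _))

    T : ℚ
    T = B * C

    -- The weight contributes `B * C ^ (j + k + 2)` and the two products in `H` contribute
    -- `2 * a j * a k`. Splitting `C ^ (j + k)` between the two factors turns the powers of `B` into
    -- powers of `T = B * C`, so the bound separates in `j` and `k`; what is left over is
    -- `2 * B * C * C`.
    ∣boundary∣≤ : ∀ j k → ∣ boundary m j k ∣ ≤ (T * C + T * C) * expTerm T j * expTerm T k
    ∣boundary∣≤ j k = ≤-trans (∣*∣≤ {weight m (j ℕ.+ k)} (∣weight∣≤ (j ℕ.+ k)) (∣H∣≤ j k)) (≤-reflexive (begin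
      B * (C * (C * C ^ (j ℕ.+ k))) * (a j * a k + a j * a k)
        ≡⟨ cong (λ z → B * (C * (C * z)) * (a j * a k + a j * a k)) (^-homo-* C j k) ⟩
      B * (C * (C * (C ^ j * C ^ k))) * (a j * a k + a j * a k)
        ≡⟨ solve 8 (λ B C cj ck fj fk bj bk →
             B :* (C :* (C :* (cj :* ck))) :* ((fj :* bj) :* (fk :* bk) :+ (fj :* bj) :* (fk :* bk))
             := ((B :* C) :* C :+ (B :* C) :* C) :* (fj :* (bj :* cj)) :* (fk :* (bk :* ck)))
             refl B C (C ^ j) (C ^ k) (1/! j) (1/! k) (B ^ j) (B ^ k) ⟩
      (T * C + T * C) * (1/! j * (B ^ j * C ^ j)) * (1/! k * (B ^ k * C ^ k))
        ≡⟨ sym (cong₂ (λ y z → (T * C + T * C) * (1/! j * y) * (1/! k * z)) (^-distrib-* B C j) (^-distrib-* B C k)) ⟩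
      (T * C + T * C) * expTerm T j * expTerm T k ∎))
      where open ≡-Reasoning

  ∣∑boundary∣≤ : ∀ K → ∣ ∑< K (boundary m K) ∣ ≤ (B * C * C + B * C * C) * (expTerm (B * C) K * ∑< K (expTerm (B * C)))
  ∣∑boundary∣≤ K = ≤-trans (sum-abs {K} _ _ (∣boundary∣≤ K ∘ toℕ))
    (≤-reflexive (trans (sym (*-distribˡ-sum {K} ((T * C + T * C) * expTerm T K) (expTerm T ∘ toℕ)))
         (*-assoc (T * C + T * C) (expTerm T K) (∑< K (expTerm T)))))

-- Quadratic forms of graphs

indicator : ∀ {p} {P : Set p} → Dec P → ℚ
indicator d = if ⌊ d ⌋ then 1ℚ else 0ℚ

indicator-yes : ∀ {p} {P : Set p} (d : Dec P) → P → indicator d ≡ 1ℚ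
indicator-yes (yes _) _ = refl
indicator-yes (no ¬p) p = contradiction p ¬p

indicator-no : ∀ {p} {P : Set p} (d : Dec P) → ¬ P → indicator d ≡ 0ℚ
indicator-no (yes p) ¬p = contradiction p ¬p
indicator-no (no _)  _  = refl

module _ {a p} {A : Set a} {P : A → Set p} (P? : Decidable P) where

  count : List A → ℚ
  count xs = fromℕ (length (filter P? xs))

  count-∷ : ∀ x xs → count (x ∷ xs) ≡ indicator (P? x) + count xs
  count-∷ x xs with P? x
  ... | yes _ = fromℕ-suc (length (filter P? xs))
  ... | no  _ = sym (+-identityˡ (count xs))

  count-++ : ∀ xs ys → count (xs List.++ ys) ≡ count xs + count ys
  count-++ xs ys = trans (cong (fromℕ ∘ length) (ListP.filter-++ P? xs ys))
    (trans (cong fromℕ (ListP.length-++ (filter P? xs))) (fromℕ-+ (length (filter P? xs)) _))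

  count-tabulate : ∀ {n} (f : Fin n → A) → count (List.tabulate f) ≡ sum (λ i → indicator (P? (f i)))
  count-tabulate {zero}  f = refl
  count-tabulate {suc n} f = trans (count-∷ (f zero) _) (+-congˡ (indicator (P? (f zero))) (count-tabulate (f ∘ suc)))

count-cartesianProduct : ∀ {a b p} {A : Set a} {B : Set b} {P : A × B → Set p} (P? : Decidable P) →
  ∀ {m n} (f : Fin m → A) (g : Fin n → B) →
  count P? (cartesianProduct (List.tabulate f) (List.tabulate g)) ≡ sum (λ i → sum (λ j → indicator (P? (f i , g j))))
count-cartesianProduct P? {zero}  f g = refl
count-cartesianProduct P? {suc m} f g = trans (count-++ P? (List.map (f zero ,_) (List.tabulate g)) _)
  (cong₂ _+_ (trans (cong (count P?) (ListP.map-tabulate g (f zero ,_))) (count-tabulate P? (λ j → f zero , g j)))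
             (count-cartesianProduct P? (f ∘ suc) g))

module _ {n : ℕ} (X : Graph n) where
  open Graph X

  adj D : Fin n → Fin n → ℚ
  adj i j = indicator (adj? i j)
  D i j   = degreeMatrix X i j / 1

  degℚ : Fin n → ℚ
  degℚ i = fromℕ (deg X i)

  degℚ-sum : ∀ i → degℚ i ≡ sum (adj i)
  degℚ-sum i = count-tabulate (adj? i) id

  adj-sym : ∀ i j → adj i j ≡ adj j i
  adj-sym i j with adj? i j | adj? j i
  ... | yes _ | yes _ = refl
  ... | yes p | no ¬q = contradiction (symmetric p) ¬q
  ... | no ¬p | yes q = contradiction (symmetric q) ¬p
  ... | no _  | no _  = refl

  adj-nonNeg : ∀ i j → 0ℚ ≤ adj i j
  adj-nonNeg i j with adj? i j
  ... | yes _ = nonNegative⁻¹ 1ℚ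
  ... | no _  = ≤-refl

  adj-diagonal : ∀ i → adj i i ≡ 0ℚ
  adj-diagonal i = indicator-no (adj? i i) (loopless refl)

  adjacency-/1 : ∀ i j → adjacency X i j / 1 ≡ adj i j
  adjacency-/1 i j with adj? i j
  ... | yes _ = refl
  ... | no _  = refl

  D-diagonal : ∀ i → D i i ≡ degℚ i
  D-diagonal i with i Fin.≟ i
  ... | yes _ = refl
  ... | no ¬p = contradiction refl ¬p

  D-offDiagonal : ∀ i j → i ≢ j → D i j ≡ 0ℚ
  D-offDiagonal i j i≢j with i Fin.≟ j
  ... | yes p = contradiction p i≢j
  ... | no _  = refl

  D-sym : ∀ i j → D i j ≡ D j i
  D-sym i j with i Fin.≟ j
  ... | yes refl = sym (D-diagonal i)
  ... | no i≢j   = sym (D-offDiagonal j i (i≢j ∘ sym))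

  private
    edge? : (p : Fin n × Fin n) → Dec (proj₁ p Fin.< proj₂ p × Adj (proj₁ p) (proj₂ p))
    edge? (u , v) = (u Fin.<? v) ×-dec adj? u v

    oriented : Fin n → Fin n → ℚ
    oriented i j = indicator (edge? (i , j))

    oriented-< : ∀ {i j} → i Fin.< j → oriented i j ≡ adj i j
    oriented-< {i} {j} i<j with adj? i j
    ... | yes p = indicator-yes ((i Fin.<? j) ×-dec yes p) (i<j , p)
    ... | no ¬p = indicator-no ((i Fin.<? j) ×-dec no ¬p) (¬p ∘ proj₂)

    oriented-≮ : ∀ {i j} → ¬ (i Fin.< j) → oriented i j ≡ 0ℚ
    oriented-≮ {i} {j} i≮j = indicator-no (edge? (i , j)) (i≮j ∘ proj₁)

    adj-split : ∀ i j → adj i j ≡ oriented i j + oriented j i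
    adj-split i j with FinP.<-cmp i j
    ... | tri< i<j _ i≯j = sym (trans (cong₂ _+_ (oriented-< i<j) (oriented-≮ {j} {i} i≯j)) (+-identityʳ (adj i j)))
    ... | tri> i≮j _ i>j = sym (trans (cong₂ _+_ (oriented-≮ {i} {j} i≮j) (trans (oriented-< i>j) (adj-sym j i)))
                                      (+-identityˡ (adj i j)))
    ... | tri≈ i≮j refl _ = trans (adj-diagonal i) (sym (cong₂ _+_ (oriented-≮ {i} {i} i≮j) (oriented-≮ {i} {i} i≮j)))

  -- `edges` records each edge once, with its smaller endpoint first, so `adj` is `oriented` plus
  -- its transpose, and each of the two has double sum `∣E∣`.
  handshake : sum degℚ ≡ fromℕ (2 ℕ.* ∣E∣ X)
  handshake = begin
    sum degℚ                                 ≡⟨ sum-cong-≗ degℚ-sum ⟩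
    sum (λ i → sum (adj i))
      ≡⟨ sum-cong-≗ (λ i → trans (sum-cong-≗ (adj-split i)) (∑-distrib-+ (λ j → oriented i j) (λ j → oriented j i))) ⟩
    sum (λ i → sum (λ j → oriented i j) + sum (λ j → oriented j i))
      ≡⟨ ∑-distrib-+ (λ i → sum (λ j → oriented i j)) (λ i → sum (λ j → oriented j i)) ⟩
    S + sum (λ i → sum (λ j → oriented j i))        ≡⟨ +-congˡ S (∑-comm (λ i j → oriented j i)) ⟩
    S + S
      ≡⟨ cong₂ _+_ count-edges (trans count-edges (cong fromℕ (sym (ℕP.+-identityʳ (∣E∣ X))))) ⟩
    fromℕ (∣E∣ X) + fromℕ (∣E∣ X ℕ.+ 0)      ≡⟨ sym (fromℕ-+ (∣E∣ X) _) ⟩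
    fromℕ (2 ℕ.* ∣E∣ X)                      ∎
    where
    open ≡-Reasoning
    S = sum (λ i → sum (oriented i))
    count-edges : S ≡ fromℕ (∣E∣ X)
    count-edges = sym (count-cartesianProduct edge? id id)

  avgDeg-sum : .{{_ : ℕ.NonZero n}} → sum degℚ * (+ 1 / n) ≡ avgDeg X
  avgDeg-sum = trans (cong (_* (+ 1 / n)) handshake) (/-*ˡ (+ (2 ℕ.* ∣E∣ X)) n)

  module _ (M : Matrix ℤ n) (M-cases : M ≡ laplacian X ⊎ M ≡ signlessLaplacian X) where

    private
      laplacian-/1 : ∀ i j → laplacian X i j / 1 ≡ D i j - adj i j
      laplacian-/1 i j = trans (/1-+ (degreeMatrix X i j) (ℤ.- adjacency X i j))
        (+-congˡ (D i j) (trans (/1-neg (adjacency X i j)) (cong -_ (adjacency-/1 i j))))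
      signless-/1 : ∀ i j → signlessLaplacian X i j / 1 ≡ D i j + adj i j
      signless-/1 i j = trans (/1-+ (degreeMatrix X i j) (adjacency X i j)) (+-congˡ (D i j) (adjacency-/1 i j))

      entry : (∀ i j → M i j / 1 ≡ D i j - adj i j) ⊎ (∀ i j → M i j / 1 ≡ D i j + adj i j)
      entry = Sum.map (λ M≡L i j → trans (cong (λ N → N i j / 1) M≡L) (laplacian-/1 i j))
                      (λ M≡Q i j → trans (cong (λ N → N i j / 1) M≡Q) (signless-/1 i j)) M-cases

    entry-sym : ∀ i j → M i j / 1 ≡ M j i / 1
    entry-sym i j with entry
    ... | inj₁ eq = trans (eq i j) (trans (cong₂ _-_ (D-sym i j) (adj-sym i j)) (sym (eq j i)))
    ... | inj₂ eq = trans (eq i j) (trans (cong₂ _+_ (D-sym i j) (adj-sym i j)) (sym (eq j i)))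

    entry-diagonal : ∀ i → M i i / 1 ≡ degℚ i
    entry-diagonal i with entry
    ... | inj₁ eq = trans (eq i i) (trans (cong₂ _-_ (D-diagonal i) (adj-diagonal i)) (+-identityʳ (degℚ i)))
    ... | inj₂ eq = trans (eq i i) (trans (cong₂ _+_ (D-diagonal i) (adj-diagonal i)) (+-identityʳ (degℚ i)))

    private
      -- The defect is half of `adj i j` times a perfect square, of `x i + x j` for the Laplacian
      -- and of `x i - x j` for the signless one. The halves are right because every edge occurs as
      -- two ordered pairs.
      term-bound : ∀ (x : Fin n → ℚ) i j → x i * (M i j / 1 * x j)
        ≤ x i * (D i j * x j) + (½ * (adj i j * (x i * x i)) + ½ * (adj i j * (x j * x j)))
      term-bound x i j with entry
      ... | inj₁ eq rewrite eq i j = ≤-by-difference (½ * (adj i j * ((x i + x j) * (x i + x j))))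
        (*-nonNeg (nonNegative⁻¹ ½) (*-nonNeg (adj-nonNeg i j) (square-nonNeg (x i + x j))))
        (solve 4 (λ x y d a → x :* (d :* y) :+ (con ½ :* (a :* (x :* x)) :+ con ½ :* (a :* (y :* y)))
          := x :* ((d :- a) :* y) :+ con ½ :* (a :* ((x :+ y) :* (x :+ y)))) refl (x i) (x j) (D i j) (adj i j))
      ... | inj₂ eq rewrite eq i j = ≤-by-difference (½ * (adj i j * ((x i - x j) * (x i - x j))))
        (*-nonNeg (nonNegative⁻¹ ½) (*-nonNeg (adj-nonNeg i j) (square-nonNeg (x i - x j))))
        (solve 4 (λ x y d a → x :* (d :* y) :+ (con ½ :* (a :* (x :* x)) :+ con ½ :* (a :* (y :* y)))
          := x :* ((d :+ a) :* y) :+ con ½ :* (a :* ((x :- y) :* (x :- y)))) refl (x i) (x j) (D i j) (adj i j))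

    -- The diagonal and the adjacency part contribute one degree-weighted sum of squares each; this
    -- is the source of the factor 2 in the theorem. Real vectors suffice: for a real symmetric
    -- matrix the form of a complex vector is the sum of the forms of its real and imaginary parts.
    energy-bound : ∀ (x : Fin n → ℚ) → sum (λ i → sum (λ j → x i * (M i j / 1 * x j)))
      ≤ sum (λ i → degℚ i * (x i * x i)) + sum (λ i → degℚ i * (x i * x i))
    energy-bound x = begin
      sum (λ i → sum (λ j → x i * (M i j / 1 * x j)))
        ≤⟨ sum-mono _ _ (λ i → sum-mono _ _ (term-bound x i)) ⟩
      sum (λ i → sum (λ j → d i j + (a i j + b i j)))
        ≡⟨ ∑∑-+ d (λ i j → a i j + b i j) ⟩
      ∑∑ d + ∑∑ (λ i j → a i j + b i j)
        ≡⟨ +-congˡ (∑∑ d) (∑∑-+ a b) ⟩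
      ∑∑ d + (∑∑ a + ∑∑ b)
        ≡⟨ cong₂ _+_ diag (cong₂ _+_ half (trans b≡a half)) ⟩
      S + (½ * S + ½ * S)
        ≡⟨ solve 1 (λ s → s :+ (con ½ :* s :+ con ½ :* s) := s :+ s) refl S ⟩
      S + S ∎
      where
      open ≤-Reasoning
      ∑∑ : (Fin n → Fin n → ℚ) → ℚ
      ∑∑ f = sum (λ i → sum (f i))
      ∑∑-+ : ∀ f g → ∑∑ (λ i j → f i j + g i j) ≡ ∑∑ f + ∑∑ g
      ∑∑-+ f g = trans (sum-cong-≗ (λ i → ∑-distrib-+ (f i) (g i))) (∑-distrib-+ (sum ∘ f) (sum ∘ g))
      d a b : Fin n → Fin n → ℚ
      d i j = x i * (D i j * x j)
      a i j = ½ * (adj i j * (x i * x i))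
      b i j = ½ * (adj i j * (x j * x j))
      S = sum (λ i → degℚ i * (x i * x i))
      diag : ∑∑ d ≡ S
      diag = sum-cong-≗ λ i → trans
        (sum-single (d i) i λ j i≢j → trans (cong (λ z → x i * (z * x j)) (D-offDiagonal i j i≢j))
          (trans (cong (x i *_) (*-zeroˡ (x j))) (*-zeroʳ (x i))))
        (trans (cong (λ z → x i * (z * x i)) (D-diagonal i))
          (solve 2 (λ x d → x :* (d :* x) := d :* (x :* x)) refl (x i) (degℚ i)))
      half : ∑∑ a ≡ ½ * S
      half = trans (sum-cong-≗ λ i → trans (sym (*-distribˡ-sum ½ (λ j → adj i j * (x i * x i))))
          (cong (½ *_) (trans (sym (*-distribʳ-sum (x i * x i) (adj i))) (cong (_* (x i * x i)) (sym (degℚ-sum i))))))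
        (sym (*-distribˡ-sum ½ (λ i → degℚ i * (x i * x i))))
      b≡a : ∑∑ b ≡ ∑∑ a
      b≡a = trans (∑-comm b) (sum-cong-≗ λ i → sum-cong-≗ λ j → cong (λ z → ½ * (z * (x i * x i))) (adj-sym j i))

-- Krylov vectors and the truncated matrix exponential

⟨_,_⟩ : ∀ {n} → Vector ℚ n → Vector ℚ n → ℚ
⟨ x , y ⟩ = sum (λ i → x i * y i)

⟨,⟩-comm : ∀ {n} (x y : Vector ℚ n) → ⟨ x , y ⟩ ≡ ⟨ y , x ⟩
⟨,⟩-comm x y = sum-cong-≗ λ i → *-comm (x i) (y i)

combination : ∀ {n K} → Vector ℚ K → (Fin K → Vector ℚ n) → Vector ℚ n
combination a x i = sum (λ k → a k * x k i)

⟨,⟩-linearˡ : ∀ {n K} (a : Vector ℚ K) (x : Fin K → Vector ℚ n) (y : Vector ℚ n) →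
  ⟨ combination a x , y ⟩ ≡ sum (λ k → a k * ⟨ x k , y ⟩)
⟨,⟩-linearˡ a x y = trans
  (sum-cong-≗ λ i → *-distribʳ-sum (y i) (λ k → a k * x k i))
  (trans (∑-comm λ i k → a k * x k i * y i)
    (sum-cong-≗ λ k → trans (sum-cong-≗ λ i → *-assoc (a k) (x k i) (y i))
                            (sym (*-distribˡ-sum (a k) (λ i → x k i * y i)))))

⟨,⟩-bilinear : ∀ {n K L} (a : Vector ℚ K) (b : Vector ℚ L) (x : Fin K → Vector ℚ n) (y : Fin L → Vector ℚ n) →
  ⟨ combination a x , combination b y ⟩ ≡ sum (λ j → sum (λ k → ⟨ x j , y k ⟩ * (a j * b k)))
⟨,⟩-bilinear a b x y = trans (⟨,⟩-linearˡ a x (combination b y)) (sum-cong-≗ λ j → begin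
  a j * ⟨ x j , combination b y ⟩
    ≡⟨ cong (a j *_) (trans (⟨,⟩-comm (x j) (combination b y)) (⟨,⟩-linearˡ b y (x j))) ⟩
  a j * sum (λ k → b k * ⟨ y k , x j ⟩)
    ≡⟨ *-distribˡ-sum (a j) (λ k → b k * ⟨ y k , x j ⟩) ⟩
  sum (λ k → a j * (b k * ⟨ y k , x j ⟩))
    ≡⟨ sum-cong-≗ (λ k → trans (cong (λ z → a j * (b k * z)) (⟨,⟩-comm (y k) (x j)))
         (solve 3 (λ a b z → a :* (b :* z) := z :* (a :* b)) refl (a j) (b k) ⟨ x j , y k ⟩)) ⟩
  sum (λ k → ⟨ x j , y k ⟩ * (a j * b k)) ∎)
  where open ≡-Reasoning

module Krylov {n : ℕ} (A : Fin n → Fin n → ℚ) (u : Fin n) where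

  apply : Vector ℚ n → Vector ℚ n
  apply x i = sum (λ l → A i l * x l)

  krylov : ℕ → Vector ℚ n
  krylov zero    i = indicator (i Fin.≟ u)
  krylov (suc k)   = apply (krylov k)

  ⟨krylov₀,⟩ : ∀ x → ⟨ krylov 0 , x ⟩ ≡ x u
  ⟨krylov₀,⟩ x = trans
    (sum-single (λ i → krylov 0 i * x i) u λ i u≢i →
      trans (cong (_* x i) (indicator-no (i Fin.≟ u) (u≢i ∘ sym))) (*-zeroˡ (x i)))
    (trans (cong (_* x u) (indicator-yes (u Fin.≟ u) refl)) (*-identityˡ (x u)))

  -- The diagonal entry at `u` of the power `p + 1` of `A`; the shift accounts for the extra `A` in
  -- the middle of the energy form.
  moment : ℕ → ℚ
  moment p = krylov (suc p) u

  moment-zero : moment 0 ≡ A u u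
  moment-zero = trans (⟨,⟩-comm (A u) (krylov 0)) (⟨krylov₀,⟩ (A u))

  -- The sum over all entries dominates every row sum, hence the operator norm for the maximum norm,
  -- without any maximum being taken.
  norm : ℚ
  norm = sum (λ i → sum (λ j → ∣ A i j ∣))

  norm-nonNeg : 0ℚ ≤ norm
  norm-nonNeg = sum-nonNeg (λ i → sum (λ j → ∣ A i j ∣)) λ i → sum-nonNeg (λ j → ∣ A i j ∣) λ j → 0≤∣p∣ (A i j)

  ∣krylov∣≤ : ∀ k i → ∣ krylov k i ∣ ≤ norm ^ k
  ∣krylov∣≤ zero i with i Fin.≟ u
  ... | yes _ = ≤-refl
  ... | no _  = nonNegative⁻¹ 1ℚ
  ∣krylov∣≤ (suc k) i = begin
    ∣ apply (krylov k) i ∣              ≤⟨ sum-abs _ _ (λ l → ∣*∣≤ {A i l} ≤-refl (∣krylov∣≤ k l)) ⟩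
    sum (λ l → ∣ A i l ∣ * norm ^ k)    ≡⟨ sym (*-distribʳ-sum (norm ^ k) (λ l → ∣ A i l ∣)) ⟩
    sum (λ l → ∣ A i l ∣) * norm ^ k    ≤⟨ *-monoˡ (norm ^ k) (^-nonNeg k norm-nonNeg)
                                             (term≤sum (λ i → sum (λ l → ∣ A i l ∣))
                                               (λ i → sum-nonNeg (λ l → ∣ A i l ∣) λ l → 0≤∣p∣ (A i l)) i) ⟩
    norm * norm ^ k                     ∎
    where open ≤-Reasoning

  module _ (A-sym : ∀ i j → A i j ≡ A j i) where

    apply-selfAdjoint : ∀ x y → ⟨ apply x , y ⟩ ≡ ⟨ x , apply y ⟩
    apply-selfAdjoint x y = begin
      sum (λ i → sum (λ l → A i l * x l) * y i)    ≡⟨ sum-cong-≗ (λ i → *-distribʳ-sum (y i) (λ l → A i l * x l)) ⟩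
      sum (λ i → sum (λ l → A i l * x l * y i))    ≡⟨ ∑-comm (λ i l → A i l * x l * y i) ⟩
      sum (λ l → sum (λ i → A i l * x l * y i))    ≡⟨ sum-cong-≗ (λ l → trans
                                                       (sum-cong-≗ λ i → trans (cong (λ z → z * x l * y i) (A-sym i l))
                                                         (solve 3 (λ a x y → a :* x :* y := x :* (a :* y))
                                                              refl (A l i) (x l) (y i)))
                                                       (sym (*-distribˡ-sum (x l) (λ i → A l i * y i)))) ⟩
      sum (λ l → x l * apply y l)                  ∎
      where open ≡-Reasoning

    -- Self-adjointness moves all factors of `A` to the right, leaving `krylov 0` to read off
    -- coordinate `u`. Dependence on `j + k` alone is what lets the energy telescope along
    -- antidiagonals.
    ⟨krylov,krylov⟩ : ∀ j k → ⟨ krylov j , krylov k ⟩ ≡ krylov (j ℕ.+ k) u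
    ⟨krylov,krylov⟩ zero    k = ⟨krylov₀,⟩ (krylov k)
    ⟨krylov,krylov⟩ (suc j) k = trans (apply-selfAdjoint (krylov j) (krylov k))
      (trans (⟨krylov,krylov⟩ j (suc k)) (cong (λ p → krylov p u) (ℕP.+-suc j k)))

    quadraticForm : ∀ K (a : ℕ → ℚ) → let x = combination {K = K} (a ∘ toℕ) (krylov ∘ toℕ) in
      sum (λ i → sum (λ l → x i * (A i l * x l)))
        ≡ ∑< K (λ j → ∑< K (λ k → moment (j ℕ.+ k) * (a j * a k)))
    quadraticForm K a = begin
      sum (λ i → sum (λ l → x i * (A i l * x l)))
        ≡⟨ sum-cong-≗ (λ i → sym (*-distribˡ-sum (x i) (λ l → A i l * x l))) ⟩
      ⟨ x , apply x ⟩
        ≡⟨ sum-cong-≗ (λ i → cong (x i *_) (apply-x i)) ⟩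
      ⟨ x , combination {K = K} (a ∘ toℕ) (krylov ∘ suc ∘ toℕ) ⟩
        ≡⟨ ⟨,⟩-bilinear {K = K} {K} (a ∘ toℕ) (a ∘ toℕ) (krylov ∘ toℕ) (krylov ∘ suc ∘ toℕ) ⟩
      sum {K} (λ j → sum {K} (λ k → ⟨ krylov (toℕ j) , krylov (suc (toℕ k)) ⟩ * (a (toℕ j) * a (toℕ k))))
        ≡⟨ sum-cong-≗ {K} (λ j → sum-cong-≗ {K} (λ k → cong (_* (a (toℕ j) * a (toℕ k)))
             (trans (⟨krylov,krylov⟩ (toℕ j) (suc (toℕ k))) (cong (λ p → krylov p u) (ℕP.+-suc (toℕ j) (toℕ k)))))) ⟩
      ∑< K (λ j → ∑< K (λ k → moment (j ℕ.+ k) * (a j * a k))) ∎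
      where
      open ≡-Reasoning
      x = combination {K = K} (a ∘ toℕ) (krylov ∘ toℕ)
      apply-x : ∀ i → apply x i ≡ combination {K = K} (a ∘ toℕ) (krylov ∘ suc ∘ toℕ) i
      apply-x i = trans (⟨,⟩-comm (A i) x) (trans (⟨,⟩-linearˡ {K = K} (a ∘ toℕ) (krylov ∘ toℕ) (A i))
        (sum-cong-≗ {K} (λ k → cong (a (toℕ k) *_) (⟨,⟩-comm (krylov (toℕ k)) (A i)))))

-- Rational entries of the complex matrix exponential

∑ℂ-re : ∀ {n} (f : Vector ℂ n) N → seq (re (∑ℂ f)) N ≡ sum (λ i → seq (re (f i)) N)
∑ℂ-re {zero}  f N = refl
∑ℂ-re {suc n} f N = +-congˡ (seq (re (f zero)) N) (∑ℂ-re (f ∘ suc) N)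

∑ℂ-im : ∀ {n} (f : Vector ℂ n) N → seq (im (∑ℂ f)) N ≡ sum (λ i → seq (im (f i)) N)
∑ℂ-im {zero}  f N = refl
∑ℂ-im {suc n} f N = +-congˡ (seq (im (f zero)) N) (∑ℂ-im (f ∘ suc) N)

∑ℝ-seq : ∀ {n} (f : Vector ℝ n) N → seq (∑ℝ f) N ≡ sum (λ i → seq (f i) N)
∑ℝ-seq {zero}  f N = refl
∑ℝ-seq {suc n} f N = +-congˡ (seq (f zero) N) (∑ℝ-seq (f ∘ suc) N)

module _ {n : ℕ} (U : Matrix ℂ n) (u j : Fin n) (N : ℕ) where

  private
    a b : Fin n → ℚ
    a k = seq (re (U j k)) N
    b k = seq (im (U j k)) N

    e : Fin n → ℚ
    e k = indicator (u Fin.≟ k)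

    𝐞-re : ∀ k → seq (re (𝐞 u k)) N ≡ e k
    𝐞-re k with u Fin.≟ k
    ... | yes _ = refl
    ... | no _  = refl

    𝐞-im : ∀ k → seq (im (𝐞 u k)) N ≡ 0ℚ
    𝐞-im k with u Fin.≟ k
    ... | yes _ = refl
    ... | no _  = refl

    select : ∀ (f : Fin n → ℚ) → sum (λ k → f k * e k) ≡ f u
    select f = trans (sum-single (λ k → f k * e k) u λ k u≢k →
        trans (cong (f k *_) (indicator-no (u Fin.≟ k) u≢k)) (*-zeroʳ (f k)))
      (trans (cong (f u *_) (indicator-yes (u Fin.≟ u) refl)) (*-identityʳ (f u)))

  column-re : seq (re ((U ⊛ 𝐞 u) j)) N ≡ seq (re (U j u)) N
  column-re = trans (∑ℂ-re (λ k → U j k *ℂ 𝐞 u k) N) (trans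
    (sum-cong-≗ λ k → trans (cong₂ (λ x y → a k * x - b k * y) (𝐞-re k) (𝐞-im k))
      (solve 3 (λ a b e → a :* e :- b :* con 0ℚ := a :* e) refl (a k) (b k) (e k)))
    (select a))

  column-im : seq (im ((U ⊛ 𝐞 u) j)) N ≡ seq (im (U j u)) N
  column-im = trans (∑ℂ-im (λ k → U j k *ℂ 𝐞 u k) N) (trans
    (sum-cong-≗ λ k → trans (cong₂ (λ x y → a k * y + b k * x) (𝐞-re k) (𝐞-im k))
      (solve 3 (λ a b e → a :* con 0ℚ :+ b :* e := b :* e) refl (a k) (b k) (e k)))
    (select b))

module _ {n : ℕ} (M : Matrix ℤ n) (t : ℝ) (u : Fin n) (N : ℕ) where

  private
    τ : ℚ
    τ = seq t N

  open Krylov (λ i j → M i j / 1) u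
  open ExpCoefficients τ

  private
    itM : Matrix ℂ n
    itM = (iℂ *ℂ fromℝ t) · (λ i j → fromℤ (M i j))

    power-re : ∀ k j → seq (re ((itM ^ᴹ k) j u)) N ≡ re^ k * krylov k j
    power-im : ∀ k j → seq (im ((itM ^ᴹ k) j u)) N ≡ im^ k * krylov k j
    power-re zero j with j Fin.≟ u
    ... | yes _ = refl
    ... | no _  = refl
    power-re (suc k) j = trans (∑ℂ-re (λ l → itM j l *ℂ (itM ^ᴹ k) l u) N) (trans
      (sum-cong-≗ λ l → trans
        (cong₂ (λ x y → seq (re (itM j l)) N * x - seq (im (itM j l)) N * y) (power-re k l) (power-im k l))
        -- The two long factors are the real and imaginary parts of the entry of `itM`, unfolded
        -- with all their zero products: `iℂ *ℂ fromℝ t` times a real number.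
        (solve 5 (λ t m p q w →
            ((con 0ℚ :* t :- con 1ℚ :* con 0ℚ) :* m :- (con 0ℚ :* con 0ℚ :+ con 1ℚ :* t) :* con 0ℚ) :* (p :* w)
            :- ((con 0ℚ :* t :- con 1ℚ :* con 0ℚ) :* con 0ℚ :+ (con 0ℚ :* con 0ℚ :+ con 1ℚ :* t) :* m) :* (q :* w)
            := (:- (t :* q)) :* (m :* w)) refl τ (M j l / 1) (re^ k) (im^ k) (krylov k l)))
      (sym (*-distribˡ-sum (re^ (suc k)) (λ l → M j l / 1 * krylov k l))))
    power-im zero j with j Fin.≟ u
    ... | yes _ = refl
    ... | no _  = refl
    power-im (suc k) j = trans (∑ℂ-im (λ l → itM j l *ℂ (itM ^ᴹ k) l u) N) (trans
      (sum-cong-≗ λ l → trans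
        (cong₂ (λ x y → seq (re (itM j l)) N * y + seq (im (itM j l)) N * x) (power-re k l) (power-im k l))
        (solve 5 (λ t m p q w →
            ((con 0ℚ :* t :- con 1ℚ :* con 0ℚ) :* m :- (con 0ℚ :* con 0ℚ :+ con 1ℚ :* t) :* con 0ℚ) :* (q :* w)
            :+ ((con 0ℚ :* t :- con 1ℚ :* con 0ℚ) :* con 0ℚ :+ (con 0ℚ :* con 0ℚ :+ con 1ℚ :* t) :* m) :* (p :* w)
            := (t :* p) :* (m :* w)) refl τ (M j l / 1) (re^ k) (im^ k) (krylov k l)))
      (sym (*-distribˡ-sum (im^ (suc k)) (λ l → M j l / 1 * krylov k l))))

  expPartialSum-re : ∀ K j → seq (re (expPartialSum itM K j u)) N ≡ combination {K = K} (α ∘ toℕ) (krylov ∘ toℕ) j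
  expPartialSum-re K j = trans (∑ℂ-re {K} (λ k → invFactorial (toℕ k) *ℂ (itM ^ᴹ toℕ k) j u) N)
    (sum-cong-≗ {K} λ k' → let k = toℕ k' in trans
      (cong₂ (λ x y → 1/! k * x - 0ℚ * y) (power-re k j) (power-im k j))
      (solve 4 (λ f p q w → f :* (p :* w) :- con 0ℚ :* (q :* w) := (f :* p) :* w) refl (1/! k) (re^ k) (im^ k) (krylov k j)))

  expPartialSum-im : ∀ K j → seq (im (expPartialSum itM K j u)) N ≡ combination {K = K} (β ∘ toℕ) (krylov ∘ toℕ) j
  expPartialSum-im K j = trans (∑ℂ-im {K} (λ k → invFactorial (toℕ k) *ℂ (itM ^ᴹ toℕ k) j u) N)
    (sum-cong-≗ {K} λ k' → let k = toℕ k' in trans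
      (cong₂ (λ x y → 1/! k * y + 0ℚ * x) (power-re k j) (power-im k j))
      (solve 4 (λ f p q w → f :* (q :* w) :+ con 0ℚ :* (p :* w) := (f :* q) :* w) refl (1/! k) (re^ k) (im^ k) (krylov k j)))

-- Cauchy sequences at a late index

Eventually : (ℕ → Set) → Set
Eventually P = ∃[ N ] (∀ n → N ℕ.≤ n → P n)

Eventually-map : ∀ {P Q : ℕ → Set} → (∀ n → P n → Q n) → Eventually P → Eventually Q
Eventually-map f (N , h) = N , λ n N≤n → f n (h n N≤n)

Eventually-× : ∀ {P Q : ℕ → Set} → Eventually P → Eventually Q → Eventually (λ n → P n × Q n)
Eventually-× (N₁ , h₁) (N₂ , h₂) = N₁ ℕ.⊔ N₂ , λ n N≤n →
  h₁ n (ℕP.m⊔n≤o⇒m≤o N₁ N₂ N≤n) , h₂ n (ℕP.m⊔n≤o⇒n≤o N₁ N₂ N≤n)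

Eventually-suc : ∀ {P : ℕ → Set} → Eventually P → Eventually (P ∘ suc)
Eventually-suc (N , h) = N , λ n N≤n → h (suc n) (ℕP.m≤n⇒m≤1+n N≤n)

Eventually-witness : ∀ {P : ℕ → Set} → Eventually P → ∃[ n ] P n
Eventually-witness (N , h) = N , h N ℕP.≤-refl

Eventually-∀ : ∀ {k} {P : Fin k → ℕ → Set} → (∀ i → Eventually (P i)) → Eventually (λ n → ∀ i → P i n)
Eventually-∀ {zero}  h = 0 , λ _ _ ()
Eventually-∀ {suc k} h = Eventually-map (λ { n (p , q) zero → p ; n (p , q) (suc i) → q i })
  (Eventually-× (h zero) (Eventually-∀ (h ∘ suc)))

fromℚ-pos : ∀ {θ} → 0ℚ < θ → 0ℝ <ℝ fromℚ θ
fromℚ-pos {θ} 0<θ = θ , 0<θ , 0 , λ _ _ → ≤-reflexive (+-identityˡ θ)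

<ℝ⇒seq≤ : ∀ {x y} → x <ℝ y → Eventually (λ N → seq x N ≤ seq y N)
<ℝ⇒seq≤ {x} (ε , 0<ε , N , h) = N , λ n N≤n → ≤-trans (≤-by-difference {seq x n} ε (<⇒≤ 0<ε) refl) (h n N≤n)

-- The quantifiers are nested because the gap in `<ℝ`, and with it the threshold for `N`, may vary
-- with `K`.
⟶ℝ⇒seq-close : ∀ {s x θ} → s ⟶ℝ x → 0ℚ < θ →
  Eventually (λ K → Eventually (λ N → ∣ seq (s K) N - seq x N ∣ ≤ θ))
⟶ℝ⇒seq-close {s} {x} {θ} s⟶x 0<θ = Eventually-map
  (λ K (l , r) → Eventually-map
    (λ N (p , q) → ∣p∣≤ p (≤-trans (≤-reflexive (solve 2 (λ a b → :- (a :- b) := b :- a) refl (seq (s K) N) (seq x N))) q))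
    (Eventually-× (<ℝ⇒seq≤ {s K -ℝ x} {fromℚ θ} l) (<ℝ⇒seq≤ {x -ℝ s K} {fromℚ θ} r)))
  (s⟶x (fromℚ θ) (fromℚ-pos 0<θ))

seq-bounded : ∀ x → ∃[ B ] (0ℚ ≤ B × Eventually (λ N → ∣ seq x N ∣ ≤ B))
seq-bounded x with cauchy x 1ℚ (positive⁻¹ 1ℚ)
... | N , h = ∣ seq x N ∣ + 1ℚ , +-nonNeg (0≤∣p∣ (seq x N)) (nonNegative⁻¹ 1ℚ) , N , λ n N≤n → begin
  ∣ seq x n ∣                            ≡⟨ cong ∣_∣ (solve 2 (λ a b → a := b :+ (a :- b)) refl (seq x n) (seq x N)) ⟩
  ∣ seq x N + (seq x n - seq x N) ∣      ≤⟨ ∣p+q∣≤∣p∣+∣q∣ (seq x N) (seq x n - seq x N) ⟩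
  ∣ seq x N ∣ + ∣ seq x n - seq x N ∣    ≤⟨ +-monoʳ-≤ ∣ seq x N ∣ (<⇒≤ (h n N N≤n ℕP.≤-refl)) ⟩
  ∣ seq x N ∣ + 1ℚ                       ∎
  where open ≤-Reasoning

-- `0ℝ ≤ℝ x` is a negation, so the argument is by contradiction: if one late entry lies below `- θ`,
-- the Cauchy property with tolerance `½ * θ` keeps all late entries below `- (½ * θ)`, which
-- witnesses `x <ℝ 0ℝ`.
nonNegℝ⇒seq≥ : ∀ {x θ} → 0ℝ ≤ℝ x → 0ℚ < θ → Eventually (λ N → - seq x N ≤ θ)
nonNegℝ⇒seq≥ {x} {θ} 0≤x 0<θ = N , λ m N≤m → ≮⇒≥ λ θ<-xₘ → 0≤x (½ * θ , 0<½θ , N , λ n N≤n → begin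
  seq x n + ½ * θ
    ≡⟨ solve 3 (λ a b t → a :+ t := (a :- b) :+ (b :+ t)) refl (seq x n) (seq x m) (½ * θ) ⟩
  (seq x n - seq x m) + (seq x m + ½ * θ)    ≤⟨ +-monoˡ-≤ (seq x m + ½ * θ) (≤-trans (p≤∣p∣ _) (<⇒≤ (h n m N≤n N≤m))) ⟩
  ½ * θ + (seq x m + ½ * θ)
    ≡⟨ solve 2 (λ a t → con ½ :* t :+ (a :+ con ½ :* t) := t :- (:- a)) refl (seq x m) θ ⟩
  θ - - seq x m                              ≤⟨ +-monoˡ-≤ (- - seq x m) (<⇒≤ θ<-xₘ) ⟩
  - seq x m - - seq x m                      ≡⟨ +-inverseʳ (- seq x m) ⟩
  0ℚ                                         ∎)
  where
  open ≤-Reasoning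
  0<½θ : 0ℚ < ½ * θ
  0<½θ = subst (_< ½ * θ) (*-zeroʳ ½) (*-monoʳ-<-pos ½ 0<θ)
  N = proj₁ (cauchy x (½ * θ) 0<½θ)
  h = proj₂ (cauchy x (½ * θ) 0<½θ)

-- Mixing probabilities and their perturbation

probability : ∀ {n} → Matrix ℂ n → Fin n → Fin n → ℕ → ℚ
probability U u j N = seq (re (U j u)) N * seq (re (U j u)) N + seq (im (U j u)) N * seq (im (U j u)) N

module _ {n : ℕ} .{{_ : NonZero n}} (U : Matrix ℂ n) (u : Fin n) where

  deviation-re : ∀ j N → seq (re (deviation U u j)) N ≡ probability U u j N - + 1 / n
  deviation-re j N = trans
    (cong₂ (λ p q → p - q)
      (cong₂ _-_ (cong₂ _*_ (column-re U u j N) (column-re (conjMatrix U) u j N))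
                 (cong₂ _*_ (column-im U u j N) (column-im (conjMatrix U) u j N)))
      (refl {x = (+ 1 / n) * 1ℚ - 0ℚ * 0ℚ}))
    (solve 3 (λ a b w → (a :* a :- b :* (:- b)) :- (w :* con 1ℚ :- con 0ℚ :* con 0ℚ) := (a :* a :+ b :* b) :- w)
      refl (seq (re (U j u)) N) (seq (im (U j u)) N) (+ 1 / n))

  -- At a late index `r` has absolute value at most `θ`, and its square agrees with the sum of
  -- squared deviations up to the chosen tolerance `θ * θ`. Each squared coordinate is thus at most
  -- `2θ²`, which is below `(2θ)²`; taking roots gives `θ + θ`.
  probability-bound : ∀ {θ} → 0ℚ < θ → DeviationBelow (fromℚ θ) U u →
    Eventually (λ N → ∀ j → probability U u j N ≤ + 1 / n + (θ + θ))
  probability-bound {θ} 0<θ (r , (0≤r , r²≈) , r<θ) = Eventually-map bound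
    (Eventually-× (Eventually-× (<ℝ⇒seq≤ {r} {fromℚ θ} r<θ) (nonNegℝ⇒seq≥ {r} 0≤r 0<θ))
                  (r²≈ (θ * θ) 0<θ²))
    where
    open ≤-Reasoning
    0≤θ = <⇒≤ 0<θ
    0<θ² : 0ℚ < θ * θ
    0<θ² = positive⁻¹ (θ * θ) {{pos*pos⇒pos θ {{positive 0<θ}} θ {{positive 0<θ}}}}
    V = ∑ℝ (λ j → ∣ deviation U u j ∣²)
    bound : ∀ N → (seq r N ≤ θ × - seq r N ≤ θ) × ∣ seq r N * seq r N - seq V N ∣ < θ * θ →
            ∀ j → probability U u j N ≤ + 1 / n + (θ + θ)
    bound N ((r≤θ , -r≤θ) , close) j = begin
      probability U u j N                     ≡⟨ solve 2 (λ p w → p := w :+ (p :- w)) refl (probability U u j N) (+ 1 / n) ⟩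
      + 1 / n + (probability U u j N - + 1 / n) ≡⟨ +-congˡ (+ 1 / n) (sym (deviation-re j N)) ⟩
      + 1 / n + x                             ≤⟨ +-monoʳ-≤ (+ 1 / n) (square-cancel-≤ (+-nonNeg 0≤θ 0≤θ) x²≤) ⟩
      + 1 / n + (θ + θ)                       ∎
      where
      x = seq (re (deviation U u j)) N
      y = seq (im (deviation U u j)) N
      rN = seq r N
      f : Fin n → ℚ
      f j = seq ∣ deviation U u j ∣² N
      f-nonNeg : ∀ j → 0ℚ ≤ f j
      f-nonNeg j = +-nonNeg (square-nonNeg (seq (re (deviation U u j)) N)) (square-nonNeg (seq (im (deviation U u j)) N))
      r²≤ : rN * rN ≤ θ * θ
      r²≤ = ≤-trans (p≤∣p∣ (rN * rN)) (∣*∣≤ {rN} {c = rN} (∣p∣≤ r≤θ -r≤θ) (∣p∣≤ r≤θ -r≤θ))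
      x²≤ : x * x ≤ (θ + θ) * (θ + θ)
      x²≤ = begin
        x * x                           ≤⟨ ≤-by-difference (y * y) (square-nonNeg y) refl ⟩
        f j                             ≤⟨ term≤sum f f-nonNeg j ⟩
        sum f                           ≡⟨ sym (∑ℝ-seq (λ j → ∣ deviation U u j ∣²) N) ⟩
        seq V N                         ≡⟨ solve 2 (λ s q → s := q :+ :- (q :- s)) refl (seq V N) (rN * rN) ⟩
        rN * rN + - (rN * rN - seq V N)
          ≤⟨ +-mono-≤ r²≤ (≤-trans (p≤∣p∣ _) (≤-trans (≤-reflexive (∣-p∣≡∣p∣ (rN * rN - seq V N))) (<⇒≤ close))) ⟩
        θ * θ + θ * θ                   ≤⟨ ≤-by-difference (θ * θ + θ * θ) (+-nonNeg (<⇒≤ 0<θ²) (<⇒≤ 0<θ²))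
                                             (solve 1 (λ t → (t :+ t) :* (t :+ t) := (t :* t :+ t :* t) :+ (t :* t :+ t :* t))
                                                  refl θ) ⟩
        (θ + θ) * (θ + θ)               ∎

module _ {θ : ℚ} (0≤θ : 0ℚ ≤ θ) (θ≤1 : θ ≤ 1ℚ) where

  -- For `d = c - a` the cross term `2ad` is controlled by `2∣a∣ ≤ a² + 1`, so the error involves
  -- `a` only through `a²`, the quantity that mixing bounds. The remaining `d²` is at most `θ`
  -- because `θ ≤ 1ℚ`.
  square-perturbation : ∀ {a c} → ∣ c - a ∣ ≤ θ → c * c ≤ a * a + ((a * a + 1ℚ) * θ + θ)
  square-perturbation {a} {c} d≤θ = begin
    c * c
      ≡⟨ solve 2 (λ a c → c :* c := a :* a :+ ((a :* (c :- a) :+ a :* (c :- a)) :+ (c :- a) :* (c :- a))) refl a c ⟩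
    a * a + ((a * d + a * d) + d * d)           ≤⟨ +-monoʳ-≤ (a * a) (+-mono-≤ 2ad≤ d²≤) ⟩
    a * a + ((a * a + 1ℚ) * θ + θ)              ∎
    where
    open ≤-Reasoning
    d = c - a
    ad≤ : a * d ≤ ∣ a ∣ * θ
    ad≤ = ≤-trans (p≤∣p∣ (a * d)) (∣*∣≤ {a} ≤-refl d≤θ)
    ∣a∣² : ∣ a ∣ * ∣ a ∣ ≡ a * a
    ∣a∣² = trans (sym (∣p*q∣≡∣p∣*∣q∣ a a)) (0≤p⇒∣p∣≡p (square-nonNeg a))
    2∣a∣≤ : ∣ a ∣ + ∣ a ∣ ≤ a * a + 1ℚ
    2∣a∣≤ = subst (λ z → ∣ a ∣ + ∣ a ∣ ≤ z + 1ℚ) ∣a∣²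
      (≤-by-difference ((∣ a ∣ - 1ℚ) * (∣ a ∣ - 1ℚ)) (square-nonNeg (∣ a ∣ - 1ℚ))
        (solve 1 (λ x → x :* x :+ con 1ℚ := (x :+ x) :+ (x :- con 1ℚ) :* (x :- con 1ℚ)) refl ∣ a ∣))
    2ad≤ : a * d + a * d ≤ (a * a + 1ℚ) * θ
    2ad≤ = ≤-trans (+-mono-≤ ad≤ ad≤) (≤-trans (≤-reflexive (sym (*-distribʳ-+ θ ∣ a ∣ ∣ a ∣))) (*-monoˡ θ 0≤θ 2∣a∣≤))
    d²≤ : d * d ≤ θ
    d²≤ = ≤-trans (≤-trans (p≤∣p∣ (d * d)) (∣*∣≤ {d} {c = d} d≤θ d≤θ))
      (≤-trans (*-monoʳ θ 0≤θ θ≤1) (≤-reflexive (*-identityʳ θ)))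

  -- Here 9 = 2 + 3 + 4: the 2 is already in the hypothesis, the 3 bounds `a² + b²` as a factor of
  -- `θ` (at most `1 + 2θ`), and each of the two squares adds `2θ`.
  modulus-perturbation : ∀ {a b c s ν} → ν ≤ 1ℚ → a * a + b * b ≤ ν + (θ + θ) →
    ∣ c - a ∣ ≤ θ → ∣ s - b ∣ ≤ θ → c * c + s * s ≤ ν + fromℕ 9 * θ
  modulus-perturbation {a} {b} {c} {s} {ν} ν≤1 mod c-a s-b = begin
    c * c + s * s
      ≤⟨ +-mono-≤ (square-perturbation {a} {c} c-a) (square-perturbation {b} {s} s-b) ⟩
    (a * a + ((a * a + 1ℚ) * θ + θ)) + (b * b + ((b * b + 1ℚ) * θ + θ))
      ≡⟨ solve 3 (λ x y t → (x :+ ((x :+ con 1ℚ) :* t :+ t)) :+ (y :+ ((y :+ con 1ℚ) :* t :+ t))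
           := (x :+ y) :+ ((x :+ y) :* t :+ con (fromℕ 4) :* t)) refl (a * a) (b * b) θ ⟩
    q + (q * θ + fromℕ 4 * θ)
      ≤⟨ +-mono-≤ mod (+-monoˡ-≤ (fromℕ 4 * θ) (*-monoˡ θ 0≤θ (≤-trans mod (+-mono-≤ ν≤1 (+-mono-≤ θ≤1 θ≤1))))) ⟩
    (ν + (θ + θ)) + (fromℕ 3 * θ + fromℕ 4 * θ)
      ≡⟨ solve 2 (λ v t → (v :+ (t :+ t)) :+ (con (fromℕ 3) :* t :+ con (fromℕ 4) :* t) := v :+ con (fromℕ 9) :* t)
           refl ν θ ⟩
    ν + fromℕ 9 * θ ∎
    where
    open ≤-Reasoning
    q = a * a + b * b

affine-pos : ∀ x → 0ℚ ≤ x → 0ℚ < fromℕ 18 * x + fromℕ 2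
affine-pos x 0≤x = +-mono-≤-< {0ℚ} {fromℕ 18 * x} {0ℚ} {fromℕ 2}
  (*-nonNeg {fromℕ 18} {x} (fromℕ-nonNeg 18) 0≤x) (positive⁻¹ (fromℕ 2))

-- Tolerances are cut off at 1, since the perturbation estimates are linear in `θ` only on that
-- range.
≤-from-scaled-approx : ∀ {p q s} → 0ℚ < s → (∀ θ → 0ℚ < θ → θ ≤ 1ℚ → p ≤ q + s * θ) → p ≤ q
≤-from-scaled-approx {p} {q} {s} 0<s h = ≤-from-approx λ δ 0<δ → approx δ (divide s δ 0<s 0<δ)
  where
  truncated : ∀ θ → 0ℚ < θ → ∃[ θ' ] (0ℚ < θ' × θ' ≤ 1ℚ × θ' ≤ θ)
  truncated θ 0<θ with ≤-total θ 1ℚ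
  ... | inj₁ θ≤1 = θ , 0<θ , θ≤1 , ≤-refl
  ... | inj₂ 1≤θ = 1ℚ , positive⁻¹ 1ℚ , ≤-refl , 1≤θ
  approx : ∀ δ → ∃[ θ ] (0ℚ < θ × s * θ ≡ δ) → p ≤ q + δ
  approx δ (θ , 0<θ , sθ≡δ) with truncated θ 0<θ
  ... | θ' , 0<θ' , θ'≤1 , θ'≤θ = ≤-trans (h θ' 0<θ' θ'≤1)
    (+-monoʳ-≤ q (≤-trans (*-monoʳ s (<⇒≤ 0<s) θ'≤θ) (≤-reflexive sθ≡δ)))

-- The degree bound

module _ {n : ℕ} .{{_ : NonZero n}} (X : Graph n) (M : Matrix ℤ n)
         (M-cases : M ≡ laplacian X ⊎ M ≡ signlessLaplacian X) (u : Fin n) where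

  open Krylov (λ i j → M i j / 1) u

  -- Adding the forms of the real and imaginary parts assembles `α j * α k + β j * β k = G j k` in
  -- front of each moment. The telescoping sum then leaves `moment 0`, which is the diagonal entry
  -- of `M` at `u`, and the border.
  energy-conservation : ∀ τ K → let open ExpCoefficients τ
                                    c = combination {K = suc K} (α ∘ toℕ) (krylov ∘ toℕ)
                                    s = combination {K = suc K} (β ∘ toℕ) (krylov ∘ toℕ)
                                    R = ∑< K (boundary moment K) in
    degℚ X u ≡ (sum (λ i → sum (λ l → c i * (M i l / 1 * c l))) + sum (λ i → sum (λ l → s i * (M i l / 1 * s l)))) + (R + R)
  energy-conservation τ K = sym (begin
    (Q α + Q β) + (R + R)
      ≡⟨ cong (_+ (R + R)) (cong₂ _+_ (quadraticForm M-sym (suc K) α) (quadraticForm M-sym (suc K) β)) ⟩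
    (∑∑ (λ j k → moment (j ℕ.+ k) * (α j * α k)) + ∑∑ (λ j k → moment (j ℕ.+ k) * (β j * β k))) + (R + R)
      ≡⟨ cong (_+ (R + R)) merge ⟩
    ∑∑ (λ j k → moment (j ℕ.+ k) * G j k) + (R + R)
      ≡⟨ cong (_+ (R + R)) (energy-telescope moment K) ⟩
    (moment 0 - (R + R)) + (R + R)
      ≡⟨ solve 2 (λ m r → (m :- r) :+ r := m) refl (moment 0) (R + R) ⟩
    moment 0
      ≡⟨ trans moment-zero (entry-diagonal X M M-cases u) ⟩
    degℚ X u ∎)
    where
    open ≡-Reasoning
    open ExpCoefficients τ
    R = ∑< K (boundary moment K)
    M-sym = entry-sym X M M-cases
    Q : (ℕ → ℚ) → ℚ
    Q a = let x = combination {K = suc K} (a ∘ toℕ) (krylov ∘ toℕ) in sum (λ i → sum (λ l → x i * (M i l / 1 * x l)))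
    ∑∑ : (ℕ → ℕ → ℚ) → ℚ
    ∑∑ f = ∑< (suc K) (λ j → ∑< (suc K) (f j))
    merge : ∑∑ (λ j k → moment (j ℕ.+ k) * (α j * α k)) + ∑∑ (λ j k → moment (j ℕ.+ k) * (β j * β k))
          ≡ ∑∑ (λ j k → moment (j ℕ.+ k) * G j k)
    merge = sym (trans
      (sum-cong-≗ {suc K} λ j → trans
        (sum-cong-≗ {suc K} λ k → *-distribˡ-+ (moment (toℕ j ℕ.+ toℕ k)) (α (toℕ j) * α (toℕ k)) (β (toℕ j) * β (toℕ k)))
        (∑-distrib-+ {suc K} (λ k → moment (toℕ j ℕ.+ toℕ k) * (α (toℕ j) * α (toℕ k)))
                             (λ k → moment (toℕ j ℕ.+ toℕ k) * (β (toℕ j) * β (toℕ k)))))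
      (∑-distrib-+ {suc K} (λ j → ∑< (suc K) (λ k → moment (toℕ j ℕ.+ k) * (α (toℕ j) * α k)))
                           (λ j → ∑< (suc K) (λ k → moment (toℕ j ℕ.+ k) * (β (toℕ j) * β k)))))

  total : ℚ
  total = sum (degℚ X)

  -- 18 = 2 · 9, with the 9 of modulus-perturbation; the 2 pays for R + R.
  slack : ℚ
  slack = fromℕ 18 * total + fromℕ 2

  energy-comparison : ∀ {c s : Fin n → ℚ} {θ R} → R ≤ θ →
    (∀ v → c v * c v + s v * s v ≤ + 1 / n + fromℕ 9 * θ) →
    degℚ X u ≡ (sum (λ i → sum (λ l → c i * (M i l / 1 * c l)))
         + sum (λ i → sum (λ l → s i * (M i l / 1 * s l)))) + (R + R) →
    degℚ X u ≤ fromℕ 2 * avgDeg X + slack * θ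
  energy-comparison {c} {s} {θ} {R} R≤θ small deg≡ = begin
    degℚ X u
      ≡⟨ deg≡ ⟩
    (sum (λ i → sum (λ l → c i * (M i l / 1 * c l))) + sum (λ i → sum (λ l → s i * (M i l / 1 * s l)))) + (R + R)
      ≤⟨ +-mono-≤ (+-mono-≤ (energy-bound X M M-cases c) (energy-bound X M M-cases s)) (+-mono-≤ R≤θ R≤θ) ⟩
    ((Sc + Sc) + (Ss + Ss)) + (θ + θ)
      ≡⟨ solve 3 (λ a b t → ((a :+ a) :+ (b :+ b)) :+ (t :+ t) := con (fromℕ 2) :* (a :+ b) :+ con (fromℕ 2) :* t)
           refl Sc Ss θ ⟩
    fromℕ 2 * (Sc + Ss) + fromℕ 2 * θ
      ≤⟨ +-monoˡ-≤ (fromℕ 2 * θ) (*-monoʳ (fromℕ 2) (fromℕ-nonNeg 2) S≤) ⟩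
    fromℕ 2 * (total * (+ 1 / n) + total * (fromℕ 9 * θ)) + fromℕ 2 * θ
      ≡⟨ cong (λ z → fromℕ 2 * (z + total * (fromℕ 9 * θ)) + fromℕ 2 * θ) (avgDeg-sum X) ⟩
    fromℕ 2 * (avgDeg X + total * (fromℕ 9 * θ)) + fromℕ 2 * θ
      ≡⟨ solve 3 (λ a S t → con (fromℕ 2) :* (a :+ S :* (con (fromℕ 9) :* t)) :+ con (fromℕ 2) :* t
           := con (fromℕ 2) :* a :+ (con (fromℕ 18) :* S :+ con (fromℕ 2)) :* t) refl (avgDeg X) total θ ⟩
    fromℕ 2 * avgDeg X + slack * θ ∎
    where
    open ≤-Reasoning
    Sc = sum (λ v → degℚ X v * (c v * c v))
    Ss = sum (λ v → degℚ X v * (s v * s v))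
    S≤ : Sc + Ss ≤ total * (+ 1 / n) + total * (fromℕ 9 * θ)
    S≤ = begin
      Sc + Ss
        ≡⟨ sym (∑-distrib-+ (λ v → degℚ X v * (c v * c v)) (λ v → degℚ X v * (s v * s v))) ⟩
      sum (λ v → degℚ X v * (c v * c v) + degℚ X v * (s v * s v))
        ≡⟨ sum-cong-≗ (λ v → sym (*-distribˡ-+ (degℚ X v) (c v * c v) (s v * s v))) ⟩
      sum (λ v → degℚ X v * (c v * c v + s v * s v))
        ≤⟨ sum-mono _ _ (λ v → *-monoʳ (degℚ X v) (fromℕ-nonNeg (deg X v)) (small v)) ⟩
      sum (λ v → degℚ X v * (+ 1 / n + fromℕ 9 * θ))
        ≡⟨ sym (*-distribʳ-sum (+ 1 / n + fromℕ 9 * θ) (degℚ X)) ⟩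
      total * (+ 1 / n + fromℕ 9 * θ)
        ≡⟨ *-distribˡ-+ total (+ 1 / n) (fromℕ 9 * θ) ⟩
      total * (+ 1 / n) + total * (fromℕ 9 * θ) ∎

  partialSum : ℝ → ℕ → Matrix ℂ n
  partialSum t = expPartialSum ((iℂ *ℂ fromℝ t) · (λ i j → fromℤ (M i j)))

  ColumnClose : ℝ → Matrix ℂ n → ℚ → ℕ → Fin n → ℕ → Set
  ColumnClose t U θ K v N =
    ∣ seq (re (S v u)) N - seq (re (U v u)) N ∣ ≤ θ × ∣ seq (im (S v u)) N - seq (im (U v u)) N ∣ ≤ θ
    where S = partialSum t K

  -- Stated with the bound `B` instead of the time `seq t N`, because `K` is fixed before `N` is
  -- known.
  Vanishing : ℚ → ℚ → ℕ → Set
  Vanishing θ B K =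
    (B * norm * norm + B * norm * norm) * (expTerm (B * norm) K * ∑< K (expTerm (B * norm))) ≤ θ

  degree-approx-at : ∀ {θ B} → 0ℚ ≤ θ → θ ≤ 1ℚ → ∀ t U K N →
    ∣ seq t N ∣ ≤ B →
    Vanishing θ B K →
    (∀ v → probability U u v N ≤ + 1 / n + (θ + θ)) →
    (∀ v → ColumnClose t U θ (suc K) v N) →
    degℚ X u ≤ fromℕ 2 * avgDeg X + slack * θ
  degree-approx-at {θ} {B} 0≤θ θ≤1 t U K N t≤B vanishing probable close =
    energy-comparison {c} {s} {θ} {R} R≤θ small (energy-conservation (seq t N) K)
    where
    open ExpCoefficients (seq t N)
    c s : Fin n → ℚ
    c = combination {K = suc K} (α ∘ toℕ) (krylov ∘ toℕ)
    s = combination {K = suc K} (β ∘ toℕ) (krylov ∘ toℕ)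
    R : ℚ
    R = ∑< K (boundary moment K)
    R≤θ : R ≤ θ
    R≤θ = ≤-trans (p≤∣p∣ R) (≤-trans
      (∣∑boundary∣≤ (seq t N) B norm norm-nonNeg t≤B moment (λ p → ∣krylov∣≤ (suc p) u) K)
      vanishing)
    small : ∀ v → c v * c v + s v * s v ≤ + 1 / n + fromℕ 9 * θ
    small v = modulus-perturbation 0≤θ θ≤1 {a} {b} {c v} {s v} {+ 1 / n} (1/n≤1 n) (probable v)
      (subst (λ z → ∣ z - a ∣ ≤ θ) (expPartialSum-re M t u N (suc K) v) (proj₁ (close v)))
      (subst (λ z → ∣ z - b ∣ ≤ θ) (expPartialSum-im M t u N (suc K) v) (proj₂ (close v)))
      where
      a b : ℚ
      a = seq (re (U v u)) N
      b = seq (im (U v u)) N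

  ColumnClose-eventually : ∀ t U θ → IsTransition M t U → 0ℚ < θ →
    Eventually (λ K → ∀ v → Eventually (ColumnClose t U θ K v))
  ColumnClose-eventually t U θ U-exp 0<θ = Eventually-∀
    {P = λ v K → Eventually (ColumnClose t U θ K v)} λ v → Eventually-map (λ K (p , q) → Eventually-× p q)
      (Eventually-× (⟶ℝ⇒seq-close {λ K → re (partialSum t K v u)} {re (U v u)} (proj₁ (U-exp v u)) 0<θ)
                    (⟶ℝ⇒seq-close {λ K → im (partialSum t K v u)} {im (U v u)} (proj₂ (U-exp v u)) 0<θ))

  Vanishing-eventually : ∀ {θ B} → 0ℚ < θ → 0ℚ ≤ B → Eventually (Vanishing θ B)
  Vanishing-eventually {θ} {B} 0<θ 0≤B =
    expTerm-vanishes (B * norm) 0≤T (B * norm * norm + B * norm * norm) θ (+-nonNeg 0≤TC 0≤TC) 0<θ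
    where
    0≤T = *-nonNeg 0≤B norm-nonNeg
    0≤TC = *-nonNeg 0≤T norm-nonNeg

  degree-approx : LocalεUniformMixing M u → ∀ θ → 0ℚ < θ → θ ≤ 1ℚ →
    degℚ X u ≤ fromℕ 2 * avgDeg X + slack * θ
  degree-approx mixing θ 0<θ θ≤1 = chooseTime (mixing (fromℚ θ) (fromℚ-pos 0<θ))
    where
    Goal : Set
    Goal = degℚ X u ≤ fromℕ 2 * avgDeg X + slack * θ

    chooseIndex : ∀ t U B K → Vanishing θ B K →
      ∃[ N ] (∣ seq t N ∣ ≤ B × (∀ v → probability U u v N ≤ + 1 / n + (θ + θ)) × (∀ v → ColumnClose t U θ (suc K) v N)) →
      Goal
    chooseIndex t U B K vanishing (N , t≤B , probable , close) =
      degree-approx-at (<⇒≤ 0<θ) θ≤1 t U K N t≤B vanishing probable close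

    chooseOrder : ∀ t U B → Eventually (λ N → ∣ seq t N ∣ ≤ B) → DeviationBelow (fromℚ θ) U u →
      ∃[ K ] (Vanishing θ B K × (∀ v → Eventually (ColumnClose t U θ (suc K) v))) → Goal
    chooseOrder t U B t≤B U-below (K , vanishing , close) = chooseIndex t U B K vanishing
      (Eventually-witness (Eventually-× t≤B (Eventually-×
        (probability-bound U u 0<θ U-below) (Eventually-∀ {P = ColumnClose t U θ (suc K)} close))))

    chooseTime : ∃[ t ] ∃[ U ] (IsTransition M t U × DeviationBelow (fromℚ θ) U u) → Goal
    chooseTime (t , U , U-exp , U-below) =
      chooseOrder t U (proj₁ (seq-bounded t)) (proj₂ (proj₂ (seq-bounded t))) U-below
        (Eventually-witness (Eventually-× (Vanishing-eventually 0<θ (proj₁ (proj₂ (seq-bounded t))))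
          -- The shift aligns the two conditions: the border of order `K` belongs to the partial sum
          -- with `suc K` terms, of orders 0 to `K`.
          (Eventually-suc (ColumnClose-eventually t U θ U-exp 0<θ))))

  local-bound : LocalεUniformMixing M u → degℚ X u ≤ fromℕ 2 * avgDeg X
  local-bound mixing = ≤-from-scaled-approx {degℚ X u} {fromℕ 2 * avgDeg X} {slack}
    (affine-pos total (sum-nonNeg (degℚ X) λ v → fromℕ-nonNeg (deg X v)))
    (degree-approx mixing)

theorem1 : ∀ (n : ℕ) .{{_ : NonZero n}} (X : Graph n) (M : Matrix ℤ n) →
    (M ≡ laplacian X ⊎ M ≡ signlessLaplacian X) →
    ((u : Fin n) → LocalεUniformMixing M u → + deg X u / 1 ≤ (+ 2 / 1) * avgDeg X)
    × (εUniformMixing M → + maxDeg X / 1 ≤ (+ 2 / 1) * avgDeg X)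
theorem1 n X M M-cases = local-bound X M M-cases , λ mixing →
  argmax-all id {P = λ d → + d / 1 ≤ (+ 2 / 1) * avgDeg X}
    -- `maxDeg` takes its maximum with the default value 0, so the bound is also checked for 0.
    (*-nonNeg (fromℕ-nonNeg 2) (nonNegative⁻¹ (avgDeg X) {{normalize-nonNeg (2 ℕ.* ∣E∣ X) n}}))
    (All.map⁺ (All.tabulate⁺ λ u → local-bound X M M-cases u λ ε 0<ε →
      let τ , U , U-exp , U-below = mixing ε 0<ε in τ , U , U-exp , U-below u))
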